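{- The model-checking problem for QCTL*_i under tree semantics is undecidable.
   Context: QCTL*_i extends CTL* with second-order quantifiers ∃^o p.φ over atomic propositions, annotated with a concrete observation o ⊆ [n]. Models are compound Kripke structures (CKS), whose states are tuples of local states in ∏_{i∈[n]} L_i (the L_i disjoint finite sets). Under tree semantics formulas are evaluated on the tree unfolding of the CKS from its initial state; ∃^o p.φ holds in a labelled tree t if there is a tree t' equal to t except possibly for the labelling of p, such that t' is o-uniform in p (any two nodes of the same depth whose states agree pointwise on the components indexed by o agree on p) and t' satisfies φ. The model-checking problem: given a CKS K and a QCTL*_i formula φ, decide whether the unfolding of K satisfies φ. -}

module Defs where

open import Data.Bool.Base using (Bool; true; false; T)
open import Data.Fin.Base using (Fin; toℕ)
open import Data.Fin.Properties using (toℕ-injective)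
open import Data.Fin.Subset using (Subset; _∈_)
open import Data.List.Base as List using (List; []; _∷_; _++_)
open import Data.List.Properties using (∷-injectiveʳ; ++-assoc)
open import Data.List.Relation.Unary.Any using (any?)
open import Data.Nat.Base using (ℕ; zero; suc; _+_; _<_)
open import Data.Nat.Properties using (_≟_)
open import Data.Product.Base using (Σ; ∃; ∃-syntax; _×_; _,_; proj₁)
open import Data.Sum.Base using (_⊎_)
open import Data.Vec.Base as Vec using (Vec; []; _∷_)
open import Data.Vec.Membership.Propositional.Properties using (∈-lookup)
open import Data.Vec.Relation.Unary.All as All using (All; []; _∷_)
open import Data.Vec.Relation.Unary.Unique.Propositional using (Unique)
open import Relation.Binary.PropositionalEquality
  using (_≡_; _≢_; refl; sym; trans; cong)
open import Relation.Nullary using (¬_)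
open import Relation.Nullary.Decidable using (does)

private
  variable
    n : ℕ

AP : Set
AP = ℕ

mutual
  data StateFormula (n : ℕ) : Set where
    atom  : (p : AP) → StateFormula n
    not   : (φ : StateFormula n) → StateFormula n
    _or_  : (φ φ′ : StateFormula n) → StateFormula n
    E     : (ψ : PathFormula n) → StateFormula n
    ∃[_]_∙_ : (o : Subset n) (p : AP) (φ : StateFormula n) → StateFormula n

  data PathFormula (n : ℕ) : Set where
    state : (φ : StateFormula n) → PathFormula n
    not   : (ψ : PathFormula n) → PathFormula n
    _or_  : (ψ ψ′ : PathFormula n) → PathFormula n
    X     : (ψ : PathFormula n) → PathFormula n
    _U_   : (ψ ψ′ : PathFormula n) → PathFormula n

-- The i-th set of local states is `Fin (lookup sizes i)`; tagging with i
-- makes these sets disjoint.  The set of states S ⊆ ∏ᵢ Lᵢ is finite and is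
-- given by listing its elements without repetition; a state is then
-- referred to by its position in `tuples`.  Labels are finite sets of
-- atomic propositions, listed.

record CKS (n : ℕ) : Set where
  field
    sizes       : Vec ℕ n
    size        : ℕ
    tuples      : Vec (All Fin sizes) size
    initial     : Fin size
    successors  : Vec (Subset size) size
    labels      : Vec (List AP) size
    .distinct   : Unique tuples
    .left-total : ∀ s → ∃[ s′ ] s′ ∈ Vec.lookup successors s

  State : Set
  State = Fin size

  _⟶_ : State → State → Set
  s ⟶ s′ = s′ ∈ Vec.lookup successors s

  component : (i : Fin n) → State → Fin (Vec.lookup sizes i)
  component i s = All.lookup (Vec.lookup tuples s) (∈-lookup i sizes)

  hasLabel : State → AP → Bool
  hasLabel s p = does (any? (p ≟_) (Vec.lookup labels s))

module Semantics (K : CKS n) where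
  open CKS K

  -- Nodes of the unfolding: the finite runs from the initial state.  The
  -- proofs of transition are irrelevant, so that a node is just a word.

  mutual
    data Node : Set where
      root : Node
      _▷_  : (u : Node) (s : State) .{u⟶s : last u ⟶ s} → Node

    last : Node → State
    last root    = initial
    last (u ▷ s) = s

  data IsChild : Node → Node → Set where
    child : ∀ {u s} .{u⟶s : last u ⟶ s} → IsChild u ((u ▷ s) {u⟶s})

  record Path : Set where
    field
      at   : ℕ → Node
      step : ∀ i → IsChild (at i) (at (suc i))

  open Path public

  drop : ℕ → Path → Path
  drop k π .at   i = at π (i + k)
  drop k π .step i = step π (i + k)

  -- Propositional quantification changes labels only, so every tree under
  -- consideration is a labelling of the nodes of the unfolding.

  LabelledTree : Set
  LabelledTree = Node → AP → Bool

  unfoldingTree : LabelledTree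
  unfoldingTree u = hasLabel (last u)

  -- Same depth, and agreement on the components in o at every position.

  data _≈[_]_ : Node → Subset n → Node → Set where
    root : ∀ {o} → root ≈[ o ] root
    extend : ∀ {o u v s s′} .{u⟶s : last u ⟶ s} .{v⟶s′ : last v ⟶ s′} →
             u ≈[ o ] v →
             (∀ i → i ∈ o → component i s ≡ component i s′) →
             ((u ▷ s) {u⟶s}) ≈[ o ] ((v ▷ s′) {v⟶s′})

  Uniform : Subset n → AP → LabelledTree → Set
  Uniform o p t = ∀ u v → u ≈[ o ] v → t u p ≡ t v p

  _≡[_]_ : LabelledTree → AP → LabelledTree → Set
  t ≡[ p ] t′ = ∀ u q → q ≢ p → t u q ≡ t′ u q

  mutual
    _,_⊨_ : LabelledTree → Node → StateFormula n → Set
    t , u ⊨ atom p     = T (t u p)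
    t , u ⊨ not φ      = ¬ (t , u ⊨ φ)
    t , u ⊨ (φ or φ′)  = (t , u ⊨ φ) ⊎ (t , u ⊨ φ′)
    t , u ⊨ E ψ        = ∃[ π ] (at π 0 ≡ u) × (t , π ⊨ₚ ψ)
    t , u ⊨ (∃[ o ] p ∙ φ) =
      ∃[ t′ ] (t ≡[ p ] t′) × Uniform o p t′ × (t′ , u ⊨ φ)

    _,_⊨ₚ_ : LabelledTree → Path → PathFormula n → Set
    t , π ⊨ₚ state φ   = t , at π 0 ⊨ φ
    t , π ⊨ₚ not ψ     = ¬ (t , π ⊨ₚ ψ)
    t , π ⊨ₚ (ψ or ψ′) = (t , π ⊨ₚ ψ) ⊎ (t , π ⊨ₚ ψ′)
    t , π ⊨ₚ X ψ       = t , drop 1 π ⊨ₚ ψ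
    t , π ⊨ₚ (ψ U ψ′)  =
      ∃[ k ] (t , drop k π ⊨ₚ ψ′) × (∀ j → j < k → t , drop j π ⊨ₚ ψ)

_⊨ᵗ_ : CKS n → StateFormula n → Set
K ⊨ᵗ φ = unfoldingTree , root ⊨ φ
  where open Semantics K

-- Deterministic machines with a single two-way infinite tape and binary
-- input alphabet.

data Symbol (k : ℕ) : Set where
  blank : Symbol k
  bit   : Bool → Symbol k
  work  : Fin k → Symbol k

data Direction : Set where
  left right : Direction

data Action (states k : ℕ) : Set where
  accept reject : Action states k
  move          : Fin states → Symbol k → Direction → Action states k

record TM : Set where
  field
    states      : ℕ
    workSymbols : ℕ
    start       : Fin states
    δ           : Fin states → Symbol workSymbols → Action states workSymbols

-- Cells to the left of the head (nearest first), the scanned cell, and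
-- cells to the right (nearest first); all cells not listed are blank.

record Tape (k : ℕ) : Set where
  constructor tape
  field
    before  : List (Symbol k)
    scanned : Symbol k
    after   : List (Symbol k)

module _ {k : ℕ} where

  writeMove : Symbol k → Direction → Tape k → Tape k
  writeMove a left  (tape []       _ rs)       = tape [] blank (a ∷ rs)
  writeMove a left  (tape (l ∷ ls) _ rs)       = tape ls l (a ∷ rs)
  writeMove a right (tape ls       _ [])       = tape (a ∷ ls) blank []
  writeMove a right (tape ls       _ (r ∷ rs)) = tape (a ∷ ls) r rs

  inputTape : List Bool → Tape k
  inputTape []      = tape [] blank []
  inputTape (b ∷ w) = tape [] (bit b) (List.map bit w)

module _ (M : TM) where
  open TM M
  open Tape

  -- Halts q τ a: started in state q on tape τ, the machine eventually
  -- performs the halting action a.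

  data Halts (q : Fin states) (τ : Tape workSymbols) :
             Action states workSymbols → Set where
    accepting : δ q (scanned τ) ≡ accept → Halts q τ accept
    rejecting : δ q (scanned τ) ≡ reject → Halts q τ reject
    moving    : ∀ {q′ a d r} → δ q (scanned τ) ≡ move q′ a d →
                Halts q′ (writeMove a d τ) r → Halts q τ r

  _Accepts_ : List Bool → Set
  _Accepts_ w = Halts start (inputTape w) accept

  _Rejects_ : List Bool → Set
  _Rejects_ w = Halts start (inputTape w) reject

record DecisionProblem : Set₁ where
  field
    Instance         : Set
    encode           : Instance → List Bool
    encode-injective : ∀ {x y} → encode x ≡ encode y → x ≡ y
    Yes              : Instance → Set

-- Nothing is asked of M on strings that do not encode an instance.

_Decides_ : TM → DecisionProblem → Set
M Decides P = ∀ x → ((M Accepts encode x) × Yes x) ⊎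
                    ((M Rejects encode x) × ¬ Yes x)
  where open DecisionProblem P

Undecidable : DecisionProblem → Set
Undecidable P = ¬ (∃[ M ] M Decides P)

record PrefixCode (A : Set) : Set where
  field
    enc         : A → List Bool
    prefix-free : ∀ x y {r s} → enc x ++ r ≡ enc y ++ s → x ≡ y × r ≡ s

  enc-injective : ∀ {x y} → enc x ≡ enc y → x ≡ y
  enc-injective {x} {y} eq = proj₁ (prefix-free x y {[]} {[]} (cong (_++ []) eq))

open PrefixCode

private
  variable
    A C : Set

unary : ℕ → List Bool
unary zero    = false ∷ []
unary (suc m) = true ∷ unary m

ℕ-code : PrefixCode ℕ
ℕ-code .enc = unary
ℕ-code .prefix-free = go
  where
  go : ∀ x y {r s} → unary x ++ r ≡ unary y ++ s → x ≡ y × r ≡ s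
  go zero    zero    refl = refl , refl
  go (suc x) (suc y) eq with go x y (∷-injectiveʳ eq)
  ... | refl , eq′ = refl , eq′

Bool-code : PrefixCode Bool
Bool-code .enc b = b ∷ []
Bool-code .prefix-free b .b refl = refl , refl

via : (f : A → C) → (∀ {x y} → f x ≡ f y → x ≡ y) → PrefixCode C → PrefixCode A
via f inj c .enc x = enc c (f x)
via f inj c .prefix-free x y eq with prefix-free c (f x) (f y) eq
... | fx≡fy , eq′ = inj fx≡fy , eq′

Fin-code : ∀ {m} → PrefixCode (Fin m)
Fin-code = via toℕ toℕ-injective ℕ-code

Σ-code : {B : A → Set} → PrefixCode A → (∀ x → PrefixCode (B x)) →
         PrefixCode (Σ A B)
Σ-code c d .enc (x , y) = enc c x ++ enc (d x) y
Σ-code c d .prefix-free (x , y) (x′ , y′) {r} {s} eq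
  with prefix-free c x x′
         (trans (sym (++-assoc (enc c x) (enc (d x) y) r))
                (trans eq (++-assoc (enc c x′) (enc (d x′) y′) s)))
... | refl , eq′ with prefix-free (d x) y y′ eq′
...   | refl , eq″ = refl , eq″

×-code : PrefixCode A → PrefixCode C → PrefixCode (A × C)
×-code c d = Σ-code c (λ _ → d)

All-code : {B : A → Set} → (∀ x → PrefixCode (B x)) →
           ∀ {m} (xs : Vec A m) → PrefixCode (All B xs)
All-code c [] .enc [] = []
All-code c [] .prefix-free [] [] eq = refl , eq
All-code c (x ∷ xs) = via (λ { (b ∷ bs) → b , bs })
                          (λ { {_ ∷ _} {_ ∷ _} refl → refl })
                          (×-code (c x) (All-code c xs))

Vec-code : PrefixCode A → ∀ m → PrefixCode (Vec A m)
Vec-code c zero .enc [] = []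
Vec-code c zero .prefix-free [] [] eq = refl , eq
Vec-code c (suc m) = via (λ { (x ∷ xs) → x , xs })
                         (λ { {_ ∷ _} {_ ∷ _} refl → refl })
                         (×-code c (Vec-code c m))

List-code : PrefixCode A → PrefixCode (List A)
List-code {A} c = via toVec toVec-injective (Σ-code ℕ-code (Vec-code c))
  where
  toVec : List A → Σ ℕ (Vec A)
  toVec xs = List.length xs , Vec.fromList xs

  fromVec : Σ ℕ (Vec A) → List A
  fromVec (_ , xs) = Vec.toList xs

  fromVec∘toVec : ∀ xs → fromVec (toVec xs) ≡ xs
  fromVec∘toVec []       = refl
  fromVec∘toVec (x ∷ xs) = cong (x ∷_) (fromVec∘toVec xs)

  toVec-injective : ∀ {xs ys} → toVec xs ≡ toVec ys → xs ≡ ys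
  toVec-injective {xs} {ys} eq =
    trans (sym (fromVec∘toVec xs)) (trans (cong fromVec eq) (fromVec∘toVec ys))

Subset-code : ∀ m → PrefixCode (Subset m)
Subset-code = Vec-code Bool-code

CKS-code : ∀ n → PrefixCode (CKS n)
CKS-code n =
  via (λ K → let open CKS K in
         sizes , size , tuples , initial , successors , labels)
      (λ { {record {}} {record {}} refl → refl })
      (Σ-code (Vec-code ℕ-code n) λ sizes →
       Σ-code ℕ-code λ size →
       ×-code (Vec-code (All-code (λ _ → Fin-code) sizes) size)
      (×-code Fin-code
      (×-code (Vec-code (Subset-code size) size)
              (Vec-code (List-code ℕ-code) size))))

mutual
  stateEnc : StateFormula n → List Bool
  stateEnc φ = unary (stateTag φ) ++ stateBody φ

  stateTag : StateFormula n → ℕ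
  stateTag (atom p)       = 0
  stateTag (not φ)        = 1
  stateTag (φ or φ′)      = 2
  stateTag (E ψ)          = 3
  stateTag (∃[ o ] p ∙ φ) = 4

  stateBody : StateFormula n → List Bool
  stateBody (atom p)       = unary p
  stateBody (not φ)        = stateEnc φ
  stateBody (φ or φ′)      = stateEnc φ ++ stateEnc φ′
  stateBody (E ψ)          = pathEnc ψ
  stateBody {n} (∃[ o ] p ∙ φ) =
    enc (×-code (Subset-code n) ℕ-code) (o , p) ++ stateEnc φ

  pathEnc : PathFormula n → List Bool
  pathEnc ψ = unary (pathTag ψ) ++ pathBody ψ

  pathTag : PathFormula n → ℕ
  pathTag (state φ)  = 0
  pathTag (not ψ)    = 1
  pathTag (ψ or ψ′)  = 2
  pathTag (X ψ)      = 3
  pathTag (ψ U ψ′)   = 4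

  pathBody : PathFormula n → List Bool
  pathBody (state φ)  = stateEnc φ
  pathBody (not ψ)    = pathEnc ψ
  pathBody (ψ or ψ′)  = pathEnc ψ ++ pathEnc ψ′
  pathBody (X ψ)      = pathEnc ψ
  pathBody (ψ U ψ′)   = pathEnc ψ ++ pathEnc ψ′

private
  reassoc : ∀ (a b : List Bool) {r} a′ b′ {s} →
            (a ++ b) ++ r ≡ (a′ ++ b′) ++ s → a ++ (b ++ r) ≡ a′ ++ (b′ ++ s)
  reassoc a b {r} a′ b′ {s} eq =
    trans (sym (++-assoc a b r)) (trans eq (++-assoc a′ b′ s))

mutual
  state-prefix-free : ∀ (φ χ : StateFormula n) {r s} →
                      stateEnc φ ++ r ≡ stateEnc χ ++ s → φ ≡ χ × r ≡ s
  state-prefix-free φ χ eq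
    with prefix-free ℕ-code (stateTag φ) (stateTag χ)
           (reassoc (unary (stateTag φ)) (stateBody φ)
                    (unary (stateTag χ)) (stateBody χ) eq)
  ... | tags , eq′ = stateBody-injective φ χ tags eq′

  stateBody-injective : ∀ (φ χ : StateFormula n) {r s} →
                        stateTag φ ≡ stateTag χ →
                        stateBody φ ++ r ≡ stateBody χ ++ s → φ ≡ χ × r ≡ s
  stateBody-injective (atom p) (atom q) refl eq with prefix-free ℕ-code p q eq
  ... | refl , eq′ = refl , eq′
  stateBody-injective (not φ) (not χ) refl eq with state-prefix-free φ χ eq
  ... | refl , eq′ = refl , eq′
  stateBody-injective (φ or φ′) (χ or χ′) refl eq
    with state-prefix-free φ χ
           (reassoc (stateEnc φ) (stateEnc φ′) (stateEnc χ) (stateEnc χ′) eq)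
  ... | refl , eq′ with state-prefix-free φ′ χ′ eq′
  ...   | refl , eq″ = refl , eq″
  stateBody-injective (E ψ) (E ξ) refl eq with path-prefix-free ψ ξ eq
  ... | refl , eq′ = refl , eq′
  stateBody-injective {n} (∃[ o ] p ∙ φ) (∃[ o′ ] q ∙ χ) refl eq
    with prefix-free (×-code (Subset-code n) ℕ-code) (o , p) (o′ , q)
           (reassoc (enc (×-code (Subset-code n) ℕ-code) (o , p)) (stateEnc φ)
                    (enc (×-code (Subset-code n) ℕ-code) (o′ , q)) (stateEnc χ)
                    eq)
  ... | refl , eq′ with state-prefix-free φ χ eq′
  ...   | refl , eq″ = refl , eq″

  path-prefix-free : ∀ (ψ ξ : PathFormula n) {r s} →
                     pathEnc ψ ++ r ≡ pathEnc ξ ++ s → ψ ≡ ξ × r ≡ s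
  path-prefix-free ψ ξ eq
    with prefix-free ℕ-code (pathTag ψ) (pathTag ξ)
           (reassoc (unary (pathTag ψ)) (pathBody ψ)
                    (unary (pathTag ξ)) (pathBody ξ) eq)
  ... | tags , eq′ = pathBody-injective ψ ξ tags eq′

  pathBody-injective : ∀ (ψ ξ : PathFormula n) {r s} →
                       pathTag ψ ≡ pathTag ξ →
                       pathBody ψ ++ r ≡ pathBody ξ ++ s → ψ ≡ ξ × r ≡ s
  pathBody-injective (state φ) (state χ) refl eq with state-prefix-free φ χ eq
  ... | refl , eq′ = refl , eq′
  pathBody-injective (not ψ) (not ξ) refl eq with path-prefix-free ψ ξ eq
  ... | refl , eq′ = refl , eq′
  pathBody-injective (ψ or ψ′) (ξ or ξ′) refl eq
    with path-prefix-free ψ ξ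
           (reassoc (pathEnc ψ) (pathEnc ψ′) (pathEnc ξ) (pathEnc ξ′) eq)
  ... | refl , eq′ with path-prefix-free ψ′ ξ′ eq′
  ...   | refl , eq″ = refl , eq″
  pathBody-injective (X ψ) (X ξ) refl eq with path-prefix-free ψ ξ eq
  ... | refl , eq′ = refl , eq′
  pathBody-injective (ψ U ψ′) (ξ U ξ′) refl eq
    with path-prefix-free ψ ξ
           (reassoc (pathEnc ψ) (pathEnc ψ′) (pathEnc ξ) (pathEnc ξ′) eq)
  ... | refl , eq′ with path-prefix-free ψ′ ξ′ eq′
  ...   | refl , eq″ = refl , eq″

StateFormula-code : PrefixCode (StateFormula n)
StateFormula-code .enc         = stateEnc
StateFormula-code .prefix-free = state-prefix-free

Instance-code : PrefixCode (Σ ℕ λ n → CKS n × StateFormula n)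
Instance-code = Σ-code ℕ-code λ n → ×-code (CKS-code n) StateFormula-code

ModelChecking : DecisionProblem
ModelChecking = record
  { Instance         = Σ ℕ λ n → CKS n × StateFormula n
  ; encode           = enc Instance-code
  ; encode-injective = enc-injective Instance-code
  ; Yes              = λ (n , K , φ) → K ⊨ᵗ φ
  }

{-# OPTIONS --safe #-}
module Submission where

-- Let M be a machine.  We construct a sentence that holds in the fixed model
-- K if and only if M does not accept the encoding of this very instance.
--
-- K has two components, each carrying a bit that is free to change at every
-- step.  On the runs where the bit s is set from depth i + 1 on, a proposition
-- that sees component s only is a function of i and of the depth: it describes
-- row i of a grid.  On the runs where both bits are set at the same time, the
-- grids of the two components can be compared row by row, so that they are
-- forced to be equal; on the runs where the second bit lags by one step, row
-- i of the first is laid next to row i + 1 of the second, so that a path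
-- formula can force each row to follow from the previous one.  Rows are
-- configurations of a machine with four streams, which is made to simulate M
-- and gets stuck, violating the sentence, when M accepts.  All conditions only
-- say which propositions have to hold, hence no uniqueness is required of a
-- labelling.
--
-- Self-reference: the sentence says that no path satisfies literal d or ξ,
-- where ξ lists the violations of the conditions above and literal d says that
-- row 0 does not spell d.  Polish notation makes the encoding of literal d a
-- homomorphic image of d, up to constants on both sides.  For d the encoding
-- of ξ, the encoding of the instance is therefore computed from row 0 by a
-- machine that does not depend on d.

open import Defs

open import Data.Bool.Base using (Bool; true; false; T; if_then_else_)
open import Data.Fin.Base using (Fin; zero; suc; toℕ)
open import Data.Fin using (#_)
open import Data.Fin.Properties using (toℕ-injective)
open import Data.Fin.Subset as Subset using (Subset; ⁅_⁆)
open import Data.Fin.Subset.Properties using (∈⊤; x∈⁅x⁆; x∈⁅y⁆⇒x≡y)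
open import Data.List.Base as List
  using (List; foldr; concat; []; _∷_; _++_; length; lookup; map; concatMap; allFin;
         cartesianProduct)
open import Data.List.Membership.Propositional using (_∈_; find; lose)
open import Data.List.Membership.Propositional.Properties
  using (∈-allFin; ∈-cartesianProduct⁺; ∈-map⁺; ∈-map⁻; ∈-++⁺ˡ; ∈-++⁺ʳ)
open import Data.List.Membership.DecPropositional using (_∈?_)
open import Data.List.Properties using (++-assoc)
open import Data.List.Relation.Unary.Any as Any using (here; there; any?)
open import Data.List.Relation.Unary.Any.Properties using (lookup-index)
open import Data.Maybe.Base as Maybe using (Maybe; just; nothing)
open import Data.Nat.Base using (ℕ; zero; suc; _+_; _≤_; _<_; s≤s; s≤s⁻¹)
open import Data.Nat.Properties
  using (_≟_; +-comm; +-identityʳ; m<n⇒m<1+n; n<1+n; n≤1+n; ≤-refl; m≤n⇒m<n∨m≡n;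
         <-≤-trans; +-suc; suc-injective)
open import Data.Product.Base using (∃-syntax; _×_; _,_; proj₁; proj₂)
open import Data.Sum.Base using (_⊎_; inj₁; inj₂)
open import Data.Unit.Base using (⊤; tt)
open import Data.Vec.Base as Vec using ([]; _∷_)
open import Data.Vec.Properties using (lookup-replicate)
open import Data.Vec.Relation.Unary.All as All using ([]; _∷_)
open import Data.Vec.Relation.Unary.AllPairs using ([]; _∷_)
open import Function.Base using (id; _∘_)
open import Relation.Binary.PropositionalEquality
  using (_≡_; _≢_; refl; sym; trans; cong; cong₂; subst; _≗_)
open import Relation.Nullary using (¬_; Dec; yes; no; does; contradiction)
open import Relation.Nullary.Decidable using (T?; dec-true; dec-false; decidable-stable)

open DecisionProblem ModelChecking using (Instance; encode; Yes)
open PrefixCode using (enc)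

-- Booleans and stability under double negation

T-does : {P : Set} (P? : Dec P) → T (does P?) → P
T-does (yes p) _ = p

does-T : {P : Set} (P? : Dec P) → P → T (does P?)
does-T P? p = subst T (sym (dec-true P? p)) tt

T-stable : ∀ {b} → ¬ ¬ T b → T b
T-stable = decidable-stable (T? _)

both : {P Q : Set} → P → Q → ¬ (¬ P ⊎ ¬ Q)
both p q (inj₁ ¬p) = ¬p p
both p q (inj₂ ¬q) = ¬q q

-- The conjunction `_∧_` is a negated disjunction, so constructively its two parts are available
-- only while refuting something; every use below derives a contradiction.
both-elim : {P Q : Set} → ¬ (¬ P ⊎ ¬ Q) → ¬ (P → ¬ Q)
both-elim ¬¬ f = ¬¬ (inj₁ λ p → ¬¬ (inj₂ (f p)))

T-true : ∀ {b} → b ≡ true → T b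
T-true refl = tt

¬T-false : ∀ {b} → ¬ T b → b ≡ false
¬T-false {true}  ¬t = contradiction tt ¬t
¬T-false {false} _  = refl

T⇒true : ∀ {b} → T b → b ≡ true
T⇒true {true} _ = refl

-- Derived connectives, blocks of quantifiers and their semantics

module _ {n : ℕ} where

  infixr 6 _∧_
  infix  9 ⟨_⟩

  ⟨_⟩ : AP → PathFormula n
  ⟨ p ⟩ = state (atom p)

  _∧_ : PathFormula n → PathFormula n → PathFormula n
  ψ ∧ ψ′ = not (not ψ or not ψ′)

  -- Excluded middle for one atom; labels are Boolean, so it holds constructively in every tree.
  ⊤ₚ : PathFormula n
  ⊤ₚ = ⟨ 0 ⟩ or not ⟨ 0 ⟩

  ◇ : PathFormula n → PathFormula n
  ◇ ψ = ⊤ₚ U ψ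

  X^ : ℕ → PathFormula n → PathFormula n
  X^ zero    ψ = ψ
  X^ (suc k) ψ = X (X^ k ψ)

  ⋁ : {A : Set} → List A → (A → PathFormula n) → PathFormula n
  ⋁ []       ψ = not ⊤ₚ
  ⋁ (x ∷ xs) ψ = ψ x or ⋁ xs ψ

  quantify : List (Subset n × AP) → StateFormula n → StateFormula n
  quantify []             φ = φ
  quantify ((o , p) ∷ qs) φ = ∃[ o ] p ∙ quantify qs φ

module FormulaSemantics {n : ℕ} (K : CKS n) where

  open Semantics K

  ⊤-sat : ∀ t π → t , π ⊨ₚ ⊤ₚ
  ⊤-sat t π with T? (t (at π 0) 0)
  ... | yes p = inj₁ p
  ... | no ¬p = inj₂ ¬p

  ◇-intro : ∀ t π ψ k → t , drop k π ⊨ₚ ψ → t , π ⊨ₚ ◇ ψ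
  ◇-intro t π ψ k p = k , p , λ j _ → ⊤-sat t (drop j π)

  ⋁-intro : ∀ {A : Set} t π {xs} (ψ : A → PathFormula n) {x} → x ∈ xs →
            t , π ⊨ₚ ψ x → t , π ⊨ₚ ⋁ xs ψ
  ⋁-intro t π ψ (here refl) p = inj₁ p
  ⋁-intro t π ψ (there x∈)  p = inj₂ (⋁-intro t π ψ x∈ p)

  ⋁-elim : ∀ {A : Set} t π xs (ψ : A → PathFormula n) →
           t , π ⊨ₚ ⋁ xs ψ → ∃[ x ] x ∈ xs × (t , π ⊨ₚ ψ x)
  ⋁-elim t π []       ψ ¬⊤       = contradiction (⊤-sat t π) ¬⊤
  ⋁-elim t π (x ∷ xs) ψ (inj₁ p) = x , here refl , p
  ⋁-elim t π (x ∷ xs) ψ (inj₂ p) with ⋁-elim t π xs ψ p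
  ... | y , y∈ , q = y , there y∈ , q

  X^-sat : ∀ t π k p → (t , π ⊨ₚ X^ k ⟨ p ⟩) ≡ T (t (at π k) p)
  X^-sat t π zero    p = refl
  X^-sat t π (suc k) p =
    trans (X^-sat t (drop 1 π) k p)
          (cong (λ i → T (t (at π i) p)) (+-comm k 1))

  AgreesOff : List (Subset n × AP) → LabelledTree → LabelledTree → Set
  AgreesOff qs t t′ = ∀ u p → ¬ (p ∈ map proj₂ qs) → t u p ≡ t′ u p

  UniformFor : List (Subset n × AP) → LabelledTree → Set
  UniformFor qs t =
    ∀ {p} → p ∈ map proj₂ qs → ∃[ o ] (o , p) ∈ qs × Uniform o p t

  -- If a proposition is quantified again further in, the inner quantifier provides its uniformity;
  -- otherwise the later choices leave its labels alone.
  quantify-elim : ∀ qs {t u} φ → t , u ⊨ quantify qs φ →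
                  ∃[ t′ ] AgreesOff qs t t′ × UniformFor qs t′ × (t′ , u ⊨ φ)
  quantify-elim [] {t} φ sat = t , (λ _ _ _ → refl) , (λ ()) , sat
  quantify-elim ((o , p) ∷ qs) φ (t₁ , t≡t₁ , unif , sat)
    with quantify-elim qs φ sat
  ... | t′ , agree , unifs , sat′ =
    t′
    , (λ u q q∉ → trans (t≡t₁ u q (λ q≡p → q∉ (here q≡p)))
                        (agree u q (λ q∈ → q∉ (there q∈))))
    , unifs′
    , sat′
    where
    later : ∀ {q} → q ∈ map proj₂ qs →
            ∃[ o′ ] (o′ , q) ∈ (o , p) ∷ qs × Uniform o′ q t′
    later q∈ with unifs q∈
    ... | o′ , o′∈ , unif′ = o′ , there o′∈ , unif′

    unifs′ : UniformFor ((o , p) ∷ qs) t′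
    unifs′ (there q∈) = later q∈
    unifs′ (here refl) with _∈?_ _≟_ p (map proj₂ qs)
    ... | yes p∈ = later p∈
    ... | no p∉  = o , here refl , λ u v u≈v →
      trans (sym (agree u p p∉)) (trans (unif u v u≈v) (agree v p p∉))

  relabel : LabelledTree → AP → LabelledTree → LabelledTree
  relabel t p t* u q = if does (q ≟ p) then t* u q else t u q

  -- Each quantifier copies one proposition from `t*`. The tree reached in the end is only pointwise
  -- equal to `t*`, so `body` has to cover all such trees.
  quantify-intro : ∀ qs {t u} φ t* →
                   AgreesOff qs t t* →
                   (∀ {o p} → (o , p) ∈ qs → Uniform o p t*) →
                   (∀ t′ → (∀ v p → t′ v p ≡ t* v p) → t′ , u ⊨ φ) →
                   t , u ⊨ quantify qs φ
  quantify-intro [] {t} φ t* agree unif body =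
    body t (λ v p → agree v p (λ ()))
  quantify-intro ((o , p) ∷ qs) {t} φ t* agree unif body =
    t₁ , off , uniform , quantify-intro qs φ t* agree₁ (unif ∘ there) body
    where
    t₁ : LabelledTree
    t₁ = relabel t p t*

    on : ∀ v → t₁ v p ≡ t* v p
    on v rewrite dec-true (p ≟ p) refl = refl

    off : t ≡[ p ] t₁
    off v q q≢p rewrite dec-false (q ≟ p) q≢p = refl

    uniform : Uniform o p t₁
    uniform v w v≈w =
      trans (on v) (trans (unif (here refl) v w v≈w) (sym (on w)))

    agree₁ : AgreesOff qs t₁ t*
    agree₁ v q q∉ with q ≟ p
    ... | yes refl = on v
    ... | no  q≢p  = trans (sym (off v q q≢p)) (agree v q
                       λ { (here q≡p) → q≢p q≡p ; (there q∈) → q∉ q∈ })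

-- The model, its runs and the position of a node in the grid

-- These name the two components and, inside `K`, also the values of a bit: `I` is off and `II` is
-- on.
pattern I  = zero
pattern II = suc zero

-- State numbers are read in binary, the bit of component I being the least significant.
bits : Bool → Bool → Fin 4
bits false false = # 0
bits true  false = # 1
bits false true  = # 2
bits true  true  = # 3

K : CKS 2
K .CKS.sizes      = 2 ∷ 2 ∷ []
K .CKS.size       = 4
K .CKS.tuples     = (I ∷ I ∷ []) ∷ (II ∷ I ∷ []) ∷ (I ∷ II ∷ []) ∷ (II ∷ II ∷ []) ∷ []
K .CKS.initial    = zero
K .CKS.successors = Vec.replicate 4 Subset.⊤
K .CKS.labels     = [] ∷ (0 ∷ []) ∷ (1 ∷ []) ∷ (0 ∷ 1 ∷ []) ∷ []
K .CKS.distinct   =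
  ((λ ()) ∷ (λ ()) ∷ (λ ()) ∷ []) ∷ ((λ ()) ∷ (λ ()) ∷ []) ∷ ((λ ()) ∷ []) ∷ [] ∷ []
K .CKS.left-total s = zero , subst (zero Subset.∈_) (sym (lookup-replicate s Subset.⊤)) ∈⊤

open CKS K using (State; _⟶_; component; hasLabel)
open Semantics K
open FormulaSemantics K

any-edge : ∀ s s′ → s ⟶ s′
any-edge s s′ = subst (s′ Subset.∈_) (sym (lookup-replicate s Subset.⊤)) ∈⊤

signal : Fin 2 → State → Bool
signal s q = hasLabel q (toℕ s)

signal-bits : ∀ s (f : Fin 2 → Bool) → signal s (bits (f I) (f II)) ≡ f s
signal-bits I f with f I | f II
... | false | false = refl
... | false | true  = refl
... | true  | false = refl
... | true  | true  = refl
signal-bits II f with f I | f II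
... | false | false = refl
... | false | true  = refl
... | true  | false = refl
... | true  | true  = refl

bits-component : ∀ s (f g : Fin 2 → Bool) → f s ≡ g s →
                 component s (bits (f I) (f II)) ≡ component s (bits (g I) (g II))
bits-component s f g eq = trans (value s f) (trans (cong (digit s) eq) (sym (value s g)))
  where
  digit : ∀ s → Bool → Fin (Vec.lookup (2 ∷ 2 ∷ []) s)
  digit I  false = I
  digit I  true  = II
  digit II false = I
  digit II true  = II

  value : ∀ s (f : Fin 2 → Bool) → component s (bits (f I) (f II)) ≡ digit s (f s)
  value I f with f I | f II
  ... | false | false = refl
  ... | false | true  = refl
  ... | true  | false = refl
  ... | true  | true  = refl
  value II f with f I | f II
  ... | false | false = refl
  ... | false | true  = refl
  ... | true  | false = refl
  ... | true  | true  = refl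

component-signal : ∀ s q q′ → component s q ≡ component s q′ →
                   signal s q ≡ signal s q′
component-signal s q q′ eq = trans (value s q) (trans (cong (read s) eq) (sym (value s q′)))
  where
  read : ∀ s → Fin (Vec.lookup (2 ∷ 2 ∷ []) s) → Bool
  read I  I  = false
  read I  II = true
  read II I  = false
  read II II = true

  value : ∀ s q → signal s q ≡ read s (component s q)
  value I  zero                   = refl
  value I  (suc zero)             = refl
  value I  (suc (suc zero))       = refl
  value I  (suc (suc (suc zero))) = refl
  value II zero                   = refl
  value II (suc zero)             = refl
  value II (suc (suc zero))       = refl
  value II (suc (suc (suc zero))) = refl

-- The state at depth 0 is fixed, hence component s carries f s k at depth suc k.
node : (Fin 2 → ℕ → Bool) → ℕ → Node
node f zero    = root
node f (suc k) =
  (node f k ▷ bits (f I k) (f II k)) {any-edge (last (node f k)) (bits (f I k) (f II k))}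

path : (Fin 2 → ℕ → Bool) → Path
path f .at     = node f
path f .step k = child

node-signal : ∀ s f k → signal s (last (node f (suc k))) ≡ f s k
node-signal s f k = signal-bits s (λ s → f s k)

root-signal : ∀ s → signal s (last root) ≡ false
root-signal I  = refl
root-signal II = refl

node-≈ : ∀ s f g → f s ≗ g s → ∀ k → node f k ≈[ ⁅ s ⁆ ] node g k
node-≈ s f g eq zero    = root
node-≈ s f g eq (suc k) = extend (node-≈ s f g eq k) agree
  where
  agree : ∀ i → i Subset.∈ ⁅ s ⁆ →
          component i (bits (f I k) (f II k)) ≡ component i (bits (g I k) (g II k))
  agree i i∈ with x∈⁅y⁆⇒x≡y s i∈
  ... | refl = bits-component s (λ s → f s k) (λ s → g s k) (eq k)

-- A node lies in row i if the signal appears first at depth suc i, and in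
-- column j of that row if it is j steps further down.
data Position : Set where
  before : ℕ → Position
  cell   : ℕ → ℕ → Position

advance : Position → Bool → Position
advance (before i) false = before (suc i)
advance (before i) true  = cell i 0
advance (cell i j) _     = cell i (suc j)

position : Fin 2 → Node → Position
position s root    = before 0
position s (u ▷ q) = advance (position s u) (signal s q)

-- Hence labels that depend on a node only through `position s` are uniform for component `s`.
position-≈ : ∀ s {u v} → u ≈[ ⁅ s ⁆ ] v → position s u ≡ position s v
position-≈ s root = refl
position-≈ s (extend {s = q} {s′ = q′} u≈v eq) =
  cong₂ advance (position-≈ s u≈v) (component-signal s q q′ (eq s (x∈⁅x⁆ s)))

position-child : ∀ s {u v} → IsChild u v →
                 position s v ≡ advance (position s u) (signal s (last v))
position-child s child = refl

signal-at : Fin 2 → Path → ℕ → Bool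
signal-at s π k = signal s (last (at π k))

position-before : ∀ s (π : Path) → at π 0 ≡ root → ∀ k →
                  (∀ j → j < suc k → signal-at s π j ≡ false) →
                  position s (at π k) ≡ before k
position-before s π eq zero    quiet = cong (position s) eq
position-before s π eq (suc k) quiet
  rewrite position-child s (step π k)
        | position-before s π eq k (λ j j< → quiet j (m<n⇒m<1+n j<))
        | quiet (suc k) (n<1+n (suc k)) = refl

-- Connects until-formulas with the grid: the first depth at which the signal is on determines the
-- row. This depth is positive because the signals are off at the root.
position-first : ∀ s (π : Path) → at π 0 ≡ root → ∀ k →
                 (∀ j → j < k → signal-at s π j ≡ false) →
                 signal-at s π k ≡ true →
                 ∃[ i ] k ≡ suc i × position s (at π k) ≡ cell i 0
position-first s π eq zero    quiet on =
  contradiction (trans (sym on) (trans (cong (signal s ∘ last) eq) (root-signal s))) λ ()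
position-first s π eq (suc i) quiet on = i , refl , pos
  where
  pos : position s (at π (suc i)) ≡ cell i 0
  pos rewrite position-child s (step π i) | position-before s π eq i quiet | on = refl

position-after : ∀ s (π : Path) {i} k → position s (at π k) ≡ cell i 0 →
                 ∀ j → position s (at π (j + k)) ≡ cell i j
position-after s π k eq zero    = eq
position-after s π k eq (suc j)
  rewrite position-child s (step π (j + k)) | position-after s π k eq j = refl

-- Off for `i` steps and on for ever after: the signal of a run that enters row `i`.
pulse : ℕ → ℕ → Bool
pulse zero    k       = true
pulse (suc i) zero    = false
pulse (suc i) (suc k) = pulse i k

pulse-on : ∀ i → pulse i i ≡ true
pulse-on zero    = refl
pulse-on (suc i) = pulse-on i

pulse-off : ∀ {i k} → k < i → pulse i k ≡ false
pulse-off {suc i} {zero}  _         = refl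
pulse-off {suc i} {suc k} (s≤s k<i) = pulse-off k<i

pulse-before : ∀ s {i k} j → j < suc i → i ≤ k → (f : Fin 2 → ℕ → Bool) → f s ≡ pulse k →
               signal s (last (node f j)) ≡ false
pulse-before s zero    _         _   f _  = root-signal s
pulse-before s (suc j) (s≤s j<i) i≤k f eq =
  trans (node-signal s f j) (trans (cong (λ g → g j) eq) (pulse-off (<-≤-trans j<i i≤k)))

-- Numbering of propositions, streams and encodings of quantifier blocks

-- Even numbers belong to component I and odd ones to II; `ap s 0` is the label that carries the
-- signal itself.
ap : Fin 2 → ℕ → AP
ap s zero    = toℕ s
ap s (suc c) = suc (suc (ap s c))

unap : AP → Fin 2 × ℕ
unap 0             = I , 0
unap 1             = II , 0
unap (suc (suc p)) = let s , c = unap p in s , suc c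

unap-ap : ∀ s c → unap (ap s c) ≡ (s , c)
unap-ap I  zero    = refl
unap-ap II zero    = refl
unap-ap s  (suc c) rewrite unap-ap s c = refl

infixr 5 _⊕_

_⊕_ : {A : Set} → List A → (ℕ → A) → ℕ → A
([]       ⊕ f) j       = f j
((x ∷ xs) ⊕ f) zero    = x
((x ∷ xs) ⊕ f) (suc j) = (xs ⊕ f) j

⊕-lookup : {A : Set} (xs : List A) (f : ℕ → A) (k : Fin (length xs)) →
           (xs ⊕ f) (toℕ k) ≡ lookup xs k
⊕-lookup (x ∷ xs) f zero    = refl
⊕-lookup (x ∷ xs) f (suc k) = ⊕-lookup xs f k

⊕-length : {A : Set} (xs : List A) (f : ℕ → A) → ∀ j → (xs ⊕ f) (length xs + j) ≡ f j
⊕-length []       f j = refl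
⊕-length (x ∷ xs) f j = ⊕-length xs f j

⊕-elim : {A : Set} (xs : List A) (f : ℕ → A) (P : ℕ → A → Set) →
         (∀ k → P (toℕ k) (lookup xs k)) →
         (∀ j → P (length xs + j) (f j)) →
         ∀ j → P j ((xs ⊕ f) j)
⊕-elim []       f P p q j       = q j
⊕-elim (x ∷ xs) f P p q zero    = p zero
⊕-elim (x ∷ xs) f P p q (suc j) = ⊕-elim xs f (P ∘ suc) (p ∘ suc) q j

-- Within `xs` the value `x` does not occur, and after `xs` nothing else does.
⊕-final : {A : Set} (xs : List A) {x : A} → ¬ (x ∈ xs) → ∀ j →
          (xs ⊕ λ _ → x) j ≡ x → (xs ⊕ λ _ → x) (suc j) ≡ x
⊕-final []       x∉ j       eq = refl
⊕-final (y ∷ xs) x∉ zero    eq = contradiction (here (sym eq)) x∉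
⊕-final (y ∷ xs) x∉ (suc j) eq = ⊕-final xs (x∉ ∘ there) j eq

-- Encodings are right-nested concatenations of constant pieces with a variable end; this gathers
-- the pieces into one constant word.
foldr-++ : ∀ (xss : List (List Bool)) r → foldr _++_ r xss ≡ concat xss ++ r
foldr-++ []         r = refl
foldr-++ (xs ∷ xss) r =
  trans (cong (xs ++_) (foldr-++ xss r)) (sym (++-assoc xs (concat xss) r))

quantifierEnc : ∀ {n} → List (Subset n × AP) → List Bool
quantifierEnc []           = []
quantifierEnc {n} (q ∷ qs) =
  concat (unary 4 ∷ enc (×-code (Subset-code n) ℕ-code) q ∷ quantifierEnc qs ∷ [])

quantify-enc : ∀ {n} qs (φ : StateFormula n) →
               stateEnc (quantify qs φ) ≡ quantifierEnc qs ++ stateEnc φ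
quantify-enc []           φ = refl
quantify-enc {n} (q ∷ qs) φ =
  trans (cong (λ r → unary 4 ++ (enc (×-code (Subset-code n) ℕ-code) q ++ r)) (quantify-enc qs φ))
        (foldr-++ (unary 4 ∷ enc (×-code (Subset-code n) ℕ-code) q ∷ quantifierEnc qs ∷ [])
                  (stateEnc φ))

-- Machines with four tracks

-- The control state is only meaningful at the head of its track; below and
-- above are the two halves of the tape, nearest cell first; stored is never
-- changed.
data Track : Set where
  control below above stored : Track

tracks : List Track
tracks = control ∷ below ∷ above ∷ stored ∷ []

∈-tracks : ∀ τ → τ ∈ tracks
∈-tracks control = here refl
∈-tracks below   = there (here refl)
∈-tracks above   = there (there (here refl))
∈-tracks stored  = there (there (there (here refl)))

-- Rich enough to move a head or to unpack a compressed value, yet every new cell is either a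
-- constant or determined by one old cell at a fixed distance, so that path formulas can check it.
record TrackUpdate (V : Set) : Set where
  constructor update
  field
    prefix  : List V
    source  : Track
    offset  : ℕ
    convert : V → V

Instruction : Set → Set
Instruction V = Track → TrackUpdate V

Configuration : Set → Set
Configuration V = Track → ℕ → V

module _ {V : Set} where

  apply : TrackUpdate V → Configuration V → ℕ → V
  apply (update xs τ m f) c = xs ⊕ λ j → f (c τ (m + j))

  -- A stuck machine keeps its configuration; this default makes runs total.
  execute : Maybe (Instruction V) → Configuration V → Configuration V
  execute nothing      c   = c
  execute (just instr) c τ = apply (instr τ) c

  -- The head of `above` is the scanned cell, and the head of `below` is the cell to its left.
  fetch : {A : Set} → (V → V → V → A) → Configuration V → A
  fetch program c = program (c above 0) (c control 0) (c below 0)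

-- Propositions for the cells of the grid

module Grid {V : Set} (values : List V) (complete : ∀ v → v ∈ values) where

  properties : List (Track × V)
  properties = cartesianProduct tracks values

  ∈-properties : ∀ γ → γ ∈ properties
  ∈-properties (τ , v) = ∈-cartesianProduct⁺ (∈-tracks τ) (complete v)

  -- The index is shifted by one because number 0 is taken by the signal.
  code : Track × V → ℕ
  code γ = suc (toℕ (Any.index (∈-properties γ)))

  code-injective : ∀ {γ γ′} → code γ ≡ code γ′ → γ ≡ γ′
  code-injective {γ} {γ′} eq =
    trans (lookup-index (∈-properties γ))
          (trans (cong (lookup properties) (toℕ-injective (suc-injective eq)))
                 (sym (lookup-index (∈-properties γ′))))

  prop : Fin 2 → Track × V → AP
  prop s γ = ap s (code γ)

  quantified : List (Subset 2 × AP)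
  quantified = map (λ (s , γ) → ⁅ s ⁆ , prop s γ)
                   (cartesianProduct (I ∷ II ∷ []) properties)

  ∈-sides : ∀ (s : Fin 2) → s ∈ I ∷ II ∷ []
  ∈-sides I  = here refl
  ∈-sides II = there (here refl)

  ∈-quantified : ∀ s γ → (⁅ s ⁆ , prop s γ) ∈ quantified
  ∈-quantified s γ =
    ∈-map⁺ _ (∈-cartesianProduct⁺ (∈-sides s) (∈-properties γ))

  quantified-prop : ∀ {o p} → (o , p) ∈ quantified →
                    ∃[ s ] ∃[ c ] o ≡ ⁅ s ⁆ × p ≡ ap s (suc c)
  quantified-prop x with ∈-map⁻ _ x
  ... | (s , γ) , _ , refl = s , toℕ (Any.index (∈-properties γ)) , refl , refl

  signal-∉ : ∀ s → ¬ (ap s 0 ∈ map proj₂ quantified)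
  signal-∉ s x with ∈-map⁻ proj₂ x
  ... | _ , y , eq with quantified-prop y
  ...   | s′ , c , _ , refl
    with trans (sym (unap-ap s 0)) (trans (cong unap eq) (unap-ap s′ (suc c)))
  ...     | ()

  -- Defined on all numbers, so that a labelling never has to invert `code`.
  shows : (Track → V) → ℕ → Bool
  shows w c = does (any? (λ τ → c ≟ code (τ , w τ)) tracks)

  shows-intro : ∀ w τ {v} → w τ ≡ v → T (shows w (code (τ , v)))
  shows-intro w τ {v} refl =
    does-T (any? (λ τ′ → code (τ , v) ≟ code (τ′ , w τ′)) tracks)
           (lose (∈-tracks τ) refl)

  shows-elim : ∀ w τ v → T (shows w (code (τ , v))) → w τ ≡ v
  shows-elim w τ v p
    with find (T-does (any? (λ τ′ → code (τ , v) ≟ code (τ′ , w τ′)) tracks) p)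
  ... | τ′ , _ , eq with code-injective eq
  ...   | refl = refl

  -- The sentence, its encoding and the violations

  module Formula (initial : Track → V) where

    a b pre : PathFormula 2
    a   = ⟨ ap I 0 ⟩
    b   = ⟨ ap II 0 ⟩
    pre = not (a or b)

    literal : List V → PathFormula 2
    literal []       = not ⟨ prop I (stored , initial stored) ⟩
    literal (v ∷ vs) = not ⟨ prop I (stored , v) ⟩ or X (literal vs)

    -- `X a` selects the paths in row 0. The formula `ξ` comes last, so that its encoding is the end
    -- of the encoding of the instance.
    sentence : List V → PathFormula 2 → StateFormula 2
    sentence vs ξ = quantify quantified (not (E ((X a ∧ X (literal vs)) or ξ)))

    negated : V → PathFormula 2
    negated v = not ⟨ prop I (stored , v) ⟩

    spelling : V → List Bool
    spelling v = concat (unary 2 ∷ pathEnc (negated v) ∷ unary 3 ∷ [])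

    closing : List Bool
    closing = pathEnc (literal [])

    -- Operators precede their arguments and `literal` nests to the right, so each letter
    -- contributes one contiguous block.
    literal-enc : ∀ vs r → pathEnc (literal vs) ++ r ≡ concatMap spelling vs ++ (closing ++ r)
    literal-enc []       r = refl
    literal-enc (v ∷ vs) r =
      trans (cong (_++ r) (foldr-++ (unary 2 ∷ pathEnc (negated v) ∷ unary 3 ∷ [])
                                    (pathEnc (literal vs))))
            (trans (++-assoc (spelling v) (pathEnc (literal vs)) r)
              (trans (cong (spelling v ++_) (literal-enc vs r))
                     (sym (++-assoc (spelling v) (concatMap spelling vs) (closing ++ r)))))

    prologue : List (List Bool)
    prologue = unary 1 ∷ unary 2 ∷ pathEnc (negation (X a)) ∷ unary 1 ∷ unary 3 ∷ []
      where
      negation : PathFormula 2 → PathFormula 2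
      negation ψ = not ψ

    -- The first `unary 2` is the number of components; the tags after the quantifiers are those of
    -- `not`, `E` and `or`.
    preliminaries : List (List Bool)
    preliminaries =
      unary 2 ∷ enc (CKS-code 2) K ∷ quantifierEnc quantified ∷
      unary 1 ∷ unary 3 ∷ unary 2 ∷ concat prologue ∷ []

    opening : List Bool
    opening = concat preliminaries

    sentence-enc : ∀ vs ξ → encode (2 , K , sentence vs ξ) ≡
                   opening ++ (concatMap spelling vs ++ (closing ++ pathEnc ξ))
    sentence-enc vs ξ =
      trans (cong (λ r → unary 2 ++ (enc (CKS-code 2) K ++ r))
                  (trans (quantify-enc quantified (not (E ((X a ∧ X (literal vs)) or ξ))))
                         (cong (λ r → quantifierEnc quantified ++
                                      (unary 1 ++ (unary 3 ++ (unary 2 ++ r)))) body)))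
            (foldr-++ preliminaries (concatMap spelling vs ++ (closing ++ pathEnc ξ)))
      where
      body : pathEnc (X a ∧ X (literal vs)) ++ pathEnc ξ ≡
             concat prologue ++ (concatMap spelling vs ++ (closing ++ pathEnc ξ))
      body = trans (cong (_++ pathEnc ξ) (foldr-++ prologue (pathEnc (literal vs))))
               (trans (++-assoc (concat prologue) (pathEnc (literal vs)) (pathEnc ξ))
                      (cong (concat prologue ++_) (literal-enc vs (pathEnc ξ))))

    -- These are evaluated where row i begins for I.  Row suc i begins one
    -- position later for II, hence the additional X in front of II.
    misplaced : (xs : List V) → Track → Fin (length xs) → PathFormula 2
    misplaced xs τ k = not (X^ (suc (toℕ k)) ⟨ prop II (τ , lookup xs k) ⟩)

    miscopied : TrackUpdate V → Track → V → PathFormula 2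
    miscopied (update xs τ′ m f) τ v =
      X^ m ⟨ prop I (τ′ , v) ⟩ ∧ not (X^ (suc (length xs)) ⟨ prop II (τ , f v) ⟩)

    mismatch : TrackUpdate V → Track → PathFormula 2
    mismatch u@(update xs _ _ _) τ =
      ⋁ (allFin (length xs)) (misplaced xs τ) or ⋁ values (λ v → ◇ (miscopied u τ v))

    -- With no instruction every continuation counts as a mismatch, so a stuck row falsifies the
    -- sentence.
    mismatches : Maybe (Instruction V) → PathFormula 2
    mismatches nothing      = ⊤ₚ
    mismatches (just instr) = ⋁ tracks λ τ → mismatch (instr τ) τ

    -- Both signals start together, so both components are in the same row. `misstep` leads from I
    -- to II; the inclusion forbidden to fail here leads back from II to I.
    desync : Track × V → PathFormula 2
    desync γ = pre U (a ∧ (b ∧ ◇ (⟨ prop II γ ⟩ ∧ not ⟨ prop I γ ⟩)))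

    misstart : Track → PathFormula 2
    misstart τ = X (a ∧ ◇ (not ⟨ prop I (τ , initial τ) ⟩))

    -- `literal` forces the stored letters and one terminator, and this forces the terminator to
    -- persist. The stored word is not mentioned, so the violations can be encoded before that word
    -- is chosen.
    misend : PathFormula 2
    misend = X (a ∧ ◇ (⟨ prop I (stored , initial stored) ⟩ ∧
                       not (X ⟨ prop I (stored , initial stored) ⟩)))

    module _ (program : V → V → V → Maybe (Instruction V)) where

      -- The signal of II appears exactly one step after that of I. There is one formula for each
      -- triple of heads, so the instruction is a constant of the formula.
      misstep : V → V → V → PathFormula 2
      misstep x y z =
        pre U (a ∧ (not b ∧ (X b ∧
          (⟨ prop I (above , x) ⟩ ∧ (⟨ prop I (control , y) ⟩ ∧ (⟨ prop I (below , z) ⟩ ∧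
            mismatches (program x y z)))))))

      violation : PathFormula 2
      violation =
        ⋁ properties desync or
        (⋁ values (λ x → ⋁ values λ y → ⋁ values λ z → misstep x y z) or
        (⋁ (control ∷ below ∷ above ∷ []) misstart or misend))

      launch : List V → Configuration V
      launch vs stored = vs ⊕ λ _ → initial stored
      launch vs τ      = λ _ → initial τ

      run : List V → ℕ → Configuration V
      run vs zero    = launch vs
      run vs (suc i) = execute (fetch program (run vs i)) (run vs i)

      -- From a satisfying labelling to the run of the machine

      module Extraction
        (vs : List V) (t : LabelledTree)
        (signals : ∀ u s → t u (ap s 0) ≡ signal s (last u))
        (uniform : ∀ s γ → Uniform ⁅ s ⁆ (prop s γ) t)
        (legal : ∀ π → at π 0 ≡ root →
                 ¬ (t , π ⊨ₚ ((X a ∧ X (literal vs)) or violation)))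
        where

        pulses : ℕ → ℕ → Fin 2 → ℕ → Bool
        pulses i k I  = pulse i
        pulses i k II = pulse k

        -- The cell is read on a canonical run where both signals are `pulse i`; row `i` begins at
        -- depth `suc i`.
        In : Fin 2 → ℕ → ℕ → Track × V → Set
        In s i j γ = T (t (node (λ _ → pulse i) (j + suc i)) (prop s γ))

        -- By uniformity, a proposition of component `s` cannot depend on the signal of the other
        -- component.
        transport : ∀ s {f g k γ} → f s ≗ g s →
                    T (t (node f k) (prop s γ)) → T (t (node g k) (prop s γ))
        transport s {f} {g} {k} {γ} f≗g =
          subst T (uniform s γ (node f k) (node g k) (node-≈ s f g f≗g k))

        signal-on : ∀ s f k → f s k ≡ true → T (t (node f (suc k)) (ap s 0))
        signal-on s f k eq =
          T-true (trans (signals (node f (suc k)) s) (trans (node-signal s f k) eq))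

        signal-off : ∀ s f k → signal s (last (node f k)) ≡ false →
                     ¬ T (t (node f k) (ap s 0))
        signal-off s f k eq p with trans (sym (T⇒true p)) (trans (signals (node f k) s) eq)
        ... | ()

        quiet : ∀ {i k} → i ≤ k → ∀ j → j < suc i → t , drop j (path (pulses i k)) ⊨ₚ pre
        quiet {i} {k} i≤k j j< (inj₁ p) =
          signal-off I (pulses i k) j (pulse-before I j j< ≤-refl (pulses i k) refl) p
        quiet {i} {k} i≤k j j< (inj₂ p) =
          signal-off II (pulses i k) j (pulse-before II j j< i≤k (pulses i k) refl) p

        legal-literal : ∀ π → at π 0 ≡ root → ¬ (t , π ⊨ₚ (X a ∧ X (literal vs)))
        legal-literal π eq p = legal π eq (inj₁ p)

        legal-sync : ∀ π → at π 0 ≡ root → ∀ γ → ¬ (t , π ⊨ₚ desync γ)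
        legal-sync π eq γ p =
          legal π eq (inj₂ (inj₁ (⋁-intro t π desync (∈-properties γ) p)))

        legal-step : ∀ π → at π 0 ≡ root → ∀ x y z → ¬ (t , π ⊨ₚ misstep x y z)
        legal-step π eq x y z p = legal π eq (inj₂ (inj₂ (inj₁
          (⋁-intro t π (λ x → ⋁ values λ y → ⋁ values λ z → misstep x y z) (complete x)
            (⋁-intro t π (λ y → ⋁ values λ z → misstep x y z) (complete y)
              (⋁-intro t π (misstep x y) (complete z) p))))))

        legal-start : ∀ π → at π 0 ≡ root → ∀ {τ} → τ ∈ control ∷ below ∷ above ∷ [] →
                      ¬ (t , π ⊨ₚ misstart τ)
        legal-start π eq τ∈ p =
          legal π eq (inj₂ (inj₂ (inj₂ (inj₁ (⋁-intro t π misstart τ∈ p)))))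

        legal-end : ∀ π → at π 0 ≡ root → ¬ (t , π ⊨ₚ misend)
        legal-end π eq p = legal π eq (inj₂ (inj₂ (inj₂ (inj₂ p))))

        origin : Path
        origin = path λ _ → pulse 0

        origin-signal : T (t (at origin 1) (ap I 0))
        origin-signal = signal-on I (λ _ → pulse 0) 0 refl

        initial-row : ∀ {τ} → τ ∈ control ∷ below ∷ above ∷ [] →
                      ∀ j → In I 0 j (τ , initial τ)
        initial-row {τ} τ∈ j = T-stable λ ¬p →
          legal-start origin refl τ∈
            (both origin-signal
              (◇-intro t (drop 1 origin) (not ⟨ prop I (τ , initial τ) ⟩) j ¬p))

        final : AP
        final = prop I (stored , initial stored)

        -- The literal forces the letters and the first terminator; persistence forces all later
        -- cells.
        literal-row : ∀ ws π → ¬ (t , π ⊨ₚ literal ws) →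
                      (∀ k → T (t (at π k) final) → T (t (at π (suc k)) final)) →
                      ∀ j → T (t (at π j) (prop I (stored , (ws ⊕ λ _ → initial stored) j)))
        literal-row []       π ok persist zero    = T-stable ok
        literal-row []       π ok persist (suc j) = persist j (literal-row [] π ok persist j)
        literal-row (w ∷ ws) π ok persist zero    = T-stable (ok ∘ inj₁)
        literal-row (w ∷ ws) π ok persist (suc j) =
          subst (λ k → T (t (at π k) (prop I (stored , (ws ⊕ λ _ → initial stored) j))))
                (+-comm j 1)
                (literal-row ws (drop 1 π) (ok ∘ inj₂) (λ k → persist (k + 1)) j)

        stored-row : ∀ j → In I 0 j (stored , launch vs stored j)
        stored-row = literal-row vs (drop 1 origin)
          (λ p → legal-literal origin refl (both origin-signal p))
          λ k p → T-stable λ ¬p → legal-end origin refl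
            (both origin-signal (◇-intro t (drop 1 origin)
              (⟨ final ⟩ ∧ not (X ⟨ final ⟩)) k (both p ¬p)))

        -- Otherwise the run with both pulses at `i` satisfies `desync γ`, as each component sees on
        -- it the same as on its canonical run.
        synchronise : ∀ i j γ → In II i j γ → In I i j γ
        synchronise i j γ p = T-stable λ ¬p →
          legal-sync (path (pulses i i)) refl γ
            ( suc i
            , both (signal-on I (pulses i i) i (pulse-on i))
                (both (signal-on II (pulses i i) i (pulse-on i))
                  (◇-intro t (drop (suc i) (path (pulses i i)))
                    (⟨ prop II γ ⟩ ∧ not ⟨ prop I γ ⟩) j
                    (both (transport II {λ _ → pulse i} {pulses i i} {γ = γ} (λ _ → refl) p)
                          (¬p ∘ transport I {pulses i i} {λ _ → pulse i} {γ = γ} (λ _ → refl)))))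
            , quiet ≤-refl )

        module _ (i : ℕ) (c : Configuration V) (shown : ∀ τ j → In I i j (τ , c τ j)) where

          advancing : Path
          advancing = path (pulses i (suc i))

          shown′ : ∀ τ j → T (t (at advancing (j + suc i)) (prop I (τ , c τ j)))
          shown′ τ j =
            transport I {λ _ → pulse i} {pulses i (suc i)} {γ = τ , c τ j} (λ _ → refl)
                      (shown τ j)

          legal-mismatches : ¬ (t , drop (suc i) advancing ⊨ₚ mismatches (fetch program c))
          legal-mismatches p =
            legal-step advancing refl (c above 0) (c control 0) (c below 0)
              ( suc i
              , both (signal-on I (pulses i (suc i)) i (pulse-on i))
                  (both (signal-off II (pulses i (suc i)) (suc i)
                          (trans (node-signal II (pulses i (suc i)) i) (pulse-off (n<1+n i))))
                    (both (signal-on II (pulses i (suc i)) (suc i) (pulse-on (suc i)))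
                      (both (shown′ above 0) (both (shown′ control 0)
                        (both (shown′ below 0) p)))))
              , quiet (n≤1+n i) )

          next-row : ∀ τ u → ¬ (t , drop (suc i) advancing ⊨ₚ mismatch u τ) →
                     ∀ j → In II (suc i) j (τ , apply u c j)
          next-row τ (update xs τ′ m f) ok =
            ⊕-elim xs (λ j → f (c τ′ (m + j))) (λ j v → In II (suc i) j (τ , v))
              (λ k → shift (toℕ k) (lookup xs k) (T-stable λ ¬p →
                ok (inj₁ (⋁-intro t π (misplaced xs τ) (∈-allFin k)
                  (¬p ∘ subst id (X^-sat t π (suc (toℕ k)) (prop II (τ , lookup xs k))))))))
              (λ j → let v = c τ′ (m + j) in shift (length xs + j) (f v) (T-stable λ ¬p →
                ok (inj₂ (⋁-intro t π (λ v → ◇ (miscopied (update xs τ′ m f) τ v)) (complete v)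
                  (◇-intro t π (miscopied (update xs τ′ m f) τ v) j
                    (both (subst id (sym (X^-sat t (drop j π) m (prop I (τ′ , v))))
                            (shown′ τ′ (m + j)))
                          (¬p ∘ subst id (X^-sat t (drop j π) (suc (length xs))
                                            (prop II (τ , f v))))))))))
            where
            π = drop (suc i) advancing

            shift : ∀ j v → T (t (at π (suc j)) (prop II (τ , v))) → In II (suc i) j (τ , v)
            shift j v p =
              subst (λ k → T (t (node (λ _ → pulse (suc i)) k) (prop II (τ , v))))
                    (sym (+-suc j (suc i)))
                    (transport II {pulses i (suc i)} {λ _ → pulse (suc i)} {γ = τ , v}
                               (λ _ → refl) p)

          not-stuck : fetch program c ≢ nothing
          not-stuck eq = legal-mismatches
            (subst (λ m → t , drop (suc i) advancing ⊨ₚ mismatches m) (sym eq)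
                   (⊤-sat t (drop (suc i) advancing)))

          -- The step condition fixes row `suc i` for II only; `synchronise` carries it over to I,
          -- which closes the induction on rows.
          shown-next : ∀ τ j → In I (suc i) j (τ , execute (fetch program c) c τ j)
          shown-next τ j =
            synchronise (suc i) j (τ , execute (fetch program c) c τ j)
                        (lemma (fetch program c) refl)
            where
            lemma : ∀ m → m ≡ fetch program c → In II (suc i) j (τ , execute m c τ j)
            lemma nothing      eq = contradiction (sym eq) not-stuck
            lemma (just instr) eq = next-row τ (instr τ)
              (λ p → legal-mismatches
                (subst (λ m → t , drop (suc i) advancing ⊨ₚ mismatches m) eq
                       (⋁-intro t (drop (suc i) advancing)
                                (λ τ → mismatch (instr τ) τ) (∈-tracks τ) p)))
              j

        shown-run : ∀ i τ j → In I i j (τ , run vs i τ j)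
        shown-run zero control = initial-row (here refl)
        shown-run zero below   = initial-row (there (here refl))
        shown-run zero above   = initial-row (there (there (here refl)))
        shown-run zero stored  = stored-row
        shown-run (suc i)      = shown-next i (run vs i) (shown-run i)

        never-stuck : ∀ i → fetch program (run vs i) ≢ nothing
        never-stuck i = not-stuck i (run vs i) (shown-run i)

      -- From an infinite run to a satisfying labelling

      module Construction
        (vs : List V) (fresh : ¬ (initial stored ∈ vs))
        (safe : ∀ i → fetch program (run vs i) ≢ nothing) where

        -- Nothing is shown before the signal; the violations read a component only within its row.
        display : Position → ℕ → Bool
        display (before _) c = false
        display (cell i j) c = shows (λ τ → run vs i τ j) c

        labelling : LabelledTree
        labelling u p =
          if does (_∈?_ _≟_ p (map proj₂ quantified))
          then (let s , c = unap p in display (position s u) c)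
          else unfoldingTree u p

        labelling-on : ∀ {p} → p ∈ map proj₂ quantified → ∀ u →
                       labelling u p ≡ (let s , c = unap p in display (position s u) c)
        labelling-on {p} p∈ u rewrite dec-true (_∈?_ _≟_ p (map proj₂ quantified)) p∈ = refl

        labelling-off : AgreesOff quantified unfoldingTree labelling
        labelling-off u p p∉ rewrite dec-false (_∈?_ _≟_ p (map proj₂ quantified)) p∉ = refl

        labelling-signal : ∀ u s → labelling u (ap s 0) ≡ signal s (last u)
        labelling-signal u s = sym (labelling-off u (ap s 0) (signal-∉ s))

        labelling-prop : ∀ u s γ →
                         labelling u (prop s γ) ≡ display (position s u) (code γ)
        labelling-prop u s γ =
          trans (labelling-on (∈-map⁺ proj₂ (∈-quantified s γ)) u)
                (cong (λ (s , c) → display (position s u) c) (unap-ap s (code γ)))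

        labelling-uniform : ∀ {o p} → (o , p) ∈ quantified → Uniform o p labelling
        labelling-uniform {p = p} x u v u≈v with quantified-prop x
        ... | s , c , refl , refl =
          trans (value u) (trans (cong (λ pos → display pos (suc c)) (position-≈ s u≈v))
                                 (sym (value v)))
          where
          value : ∀ u → labelling u (ap s (suc c)) ≡ display (position s u) (suc c)
          value u = trans (labelling-on (∈-map⁺ proj₂ x) u)
                          (cong (λ (s , c) → display (position s u) c) (unap-ap s (suc c)))

        module _ (t : LabelledTree) (t≗ : ∀ u p → t u p ≡ labelling u p) where

          signal-true : ∀ s (π : Path) k → T (t (at π k) (ap s 0)) → signal-at s π k ≡ true
          signal-true s π k p =
            trans (sym (trans (t≗ (at π k) (ap s 0)) (labelling-signal (at π k) s))) (T⇒true p)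

          signal-false : ∀ s (π : Path) k → ¬ T (t (at π k) (ap s 0)) → signal-at s π k ≡ false
          signal-false s π k ¬p =
            trans (sym (trans (t≗ (at π k) (ap s 0)) (labelling-signal (at π k) s))) (¬T-false ¬p)

          cell-prop : ∀ s u {i j} γ → position s u ≡ cell i j →
                      t u (prop s γ) ≡ shows (λ τ → run vs i τ j) (code γ)
          cell-prop s u γ eq =
            trans (t≗ u (prop s γ))
                  (trans (labelling-prop u s γ) (cong (λ pos → display pos (code γ)) eq))

          cell-intro : ∀ s u {i j} τ v → position s u ≡ cell i j → run vs i τ j ≡ v →
                       T (t u (prop s (τ , v)))
          cell-intro s u {i} {j} τ v eq eq′ =
            subst T (sym (cell-prop s u (τ , v) eq)) (shows-intro (λ τ → run vs i τ j) τ eq′)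

          cell-elim : ∀ s u {i j} τ v → position s u ≡ cell i j →
                      T (t u (prop s (τ , v))) → run vs i τ j ≡ v
          cell-elim s u {i} {j} τ v eq p =
            shows-elim (λ τ → run vs i τ j) τ v (subst T (cell-prop s u (τ , v) eq) p)

          literal-holds : ∀ ws ρ →
            (∀ j → T (t (at ρ j) (prop I (stored , (ws ⊕ λ _ → initial stored) j)))) →
            ¬ (t , ρ ⊨ₚ literal ws)
          literal-holds []       ρ shown ¬p        = ¬p (shown 0)
          literal-holds (w ∷ ws) ρ shown (inj₁ ¬p) = ¬p (shown 0)
          literal-holds (w ∷ ws) ρ shown (inj₂ p)  =
            literal-holds ws (drop 1 ρ)
              (λ j → subst (λ k → T (t (at ρ k) (prop I (stored , (ws ⊕ λ _ → initial stored) j))))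
                           (+-comm 1 j) (shown (suc j)))
              p

          module _ (i : ℕ) (ρ : Path)
                   (here-I : ∀ j → position I (at ρ j) ≡ cell i j)
                   (here-II : ∀ j → position II (at ρ (suc j)) ≡ cell (suc i) j) where

            mismatch-fails : ∀ u τ → (∀ j → run vs (suc i) τ j ≡ apply u (run vs i) j) →
                             ¬ (t , ρ ⊨ₚ mismatch u τ)
            mismatch-fails (update xs τ′ m f) τ eq (inj₁ p)
              with ⋁-elim t ρ (allFin (length xs)) (misplaced xs τ) p
            ... | k , _ , ¬q =
              ¬q (subst id (sym (X^-sat t ρ (suc (toℕ k)) (prop II (τ , lookup xs k))))
                   (cell-intro II (at ρ (suc (toℕ k))) τ (lookup xs k) (here-II (toℕ k))
                     (trans (eq (toℕ k)) (⊕-lookup xs _ k))))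
            mismatch-fails (update xs τ′ m f) τ eq (inj₂ p)
              with ⋁-elim t ρ values (λ v → ◇ (miscopied (update xs τ′ m f) τ v)) p
            ... | v , _ , k , q , _ = both-elim q λ now ¬later →
              ¬later (subst id (sym (X^-sat t (drop k ρ) (suc (length xs)) (prop II (τ , f v))))
                (cell-intro II (at ρ (suc (length xs + k))) τ (f v) (here-II (length xs + k))
                  (trans (eq (length xs + k))
                    (trans (⊕-length xs _ k)
                      (cong f (cell-elim I (at ρ (m + k)) τ′ v (here-I (m + k))
                        (subst id (X^-sat t (drop k ρ) m (prop I (τ′ , v))) now)))))))

            mismatches-fail : ¬ (t , ρ ⊨ₚ mismatches (fetch program (run vs i)))
            mismatches-fail p = lemma (fetch program (run vs i)) refl p
              where
              lemma : ∀ m → m ≡ fetch program (run vs i) → ¬ (t , ρ ⊨ₚ mismatches m)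
              lemma nothing      eq _ = safe i (sym eq)
              lemma (just instr) eq p with ⋁-elim t ρ tracks (λ τ → mismatch (instr τ) τ) p
              ... | τ , _ , q = mismatch-fails (instr τ) τ
                (λ j → cong (λ m → execute m (run vs i) τ j) (sym eq)) q

          module _ (π : Path) (rooted : at π 0 ≡ root) where

            first-row : T (t (at π 1) (ap I 0)) →
                        ∀ j → position I (at π (j + 1)) ≡ cell 0 j
            first-row p with position-first I π rooted 1
              (λ { zero _ → trans (cong (signal I ∘ last) rooted) (root-signal I)
                 ; (suc _) (s≤s ()) })
              (signal-true I π 1 p)
            ... | .0 , refl , eq = position-after I π 1 eq

            literal-fails : ¬ (t , π ⊨ₚ (X a ∧ X (literal vs)))
            literal-fails p = both-elim p λ on lit →
              literal-holds vs (drop 1 π)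
                (λ j → cell-intro I (at π (j + 1)) stored _ (first-row on j) refl) lit

            quiet-I : ∀ {k} → (∀ j → j < k → t , drop j π ⊨ₚ pre) →
                      ∀ j → j < k → signal-at I π j ≡ false
            quiet-I quiet j j< = signal-false I π j (quiet j j< ∘ inj₁)

            quiet-II : ∀ {k} → (∀ j → j < k → t , drop j π ⊨ₚ pre) →
                       ∀ j → j < k → signal-at II π j ≡ false
            quiet-II quiet j j< = signal-false II π j (quiet j j< ∘ inj₂)

            desync-fails : ∀ γ → ¬ (t , π ⊨ₚ desync γ)
            desync-fails γ (k , p , quiet) =
              both-elim p λ on-I p → both-elim p λ on-II (l , p , _) → both-elim p λ q ¬q →
              lemma on-I on-II l q ¬q
              where
              lemma : T (t (at π k) (ap I 0)) → T (t (at π k) (ap II 0)) → ∀ l →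
                      T (t (at π (l + k)) (prop II γ)) → ¬ ¬ T (t (at π (l + k)) (prop I γ))
              lemma on-I on-II l q ¬q
                with position-first I π rooted k (quiet-I quiet) (signal-true I π k on-I)
                   | position-first II π rooted k (quiet-II quiet) (signal-true II π k on-II)
              -- Both signals first appear at the same depth, so matching identifies the two rows.
              ... | i , refl , eq-I | .i , refl , eq-II =
                ¬q (subst T (trans (cell-prop II _ γ (position-after II π (suc i) eq-II l))
                              (sym (cell-prop I _ γ (position-after I π (suc i) eq-I l)))) q)

            misstep-fails : ∀ x y z → ¬ (t , π ⊨ₚ misstep x y z)
            misstep-fails x y z (k , p , quiet) =
              both-elim p λ on p → both-elim p λ off p → both-elim p λ next p →
              both-elim p λ px p → both-elim p λ py p → both-elim p λ pz p →
              lemma on off next px py pz p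
              where
              contradict : ∀ {i} → position I (at π k) ≡ cell i 0 →
                           position II (at π (suc k)) ≡ cell (suc i) 0 →
                           run vs i above 0 ≡ x → run vs i control 0 ≡ y → run vs i below 0 ≡ z →
                           ¬ (t , drop k π ⊨ₚ mismatches (program x y z))
              -- Matching turns `program x y z` into the instruction fetched in row `i`.
              contradict {i} eq-I eq-II refl refl refl =
                mismatches-fail i (drop k π) (position-after I π k eq-I)
                  (λ j → trans (cong (position II ∘ at π) (sym (+-suc j k)))
                               (position-after II π (suc k) eq-II j))

              lemma : T (t (at π k) (ap I 0)) → ¬ T (t (at π k) (ap II 0)) →
                      T (t (at π (suc k)) (ap II 0)) →
                      T (t (at π k) (prop I (above , x))) →
                      T (t (at π k) (prop I (control , y))) →
                      T (t (at π k) (prop I (below , z))) →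
                      ¬ (t , drop k π ⊨ₚ mismatches (program x y z))
              lemma on off next px py pz =
                let i  , k≡  , eq-I  = position-first I π rooted k (quiet-I quiet)
                                                      (signal-true I π k on)
                    i′ , k≡′ , eq-II = position-first II π rooted (suc k) quiet′
                                                      (signal-true II π (suc k) next)
                in contradict eq-I
                     (trans eq-II (cong (λ i → cell i 0) (trans (sym (suc-injective k≡′)) k≡)))
                     (cell-elim I (at π k) above x eq-I px)
                     (cell-elim I (at π k) control y eq-I py)
                     (cell-elim I (at π k) below z eq-I pz)
                where
                -- `pre` covers the positions below `k`, and `not b` covers `k` itself.
                quiet′ : ∀ j → j < suc k → signal-at II π j ≡ false
                quiet′ j j< with m≤n⇒m<n∨m≡n (s≤s⁻¹ j<)
                ... | inj₁ j<k  = quiet-II quiet j j<k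
                ... | inj₂ refl = signal-false II π k off

            misstart-fails : ∀ {τ} → τ ∈ control ∷ below ∷ above ∷ [] → ¬ (t , π ⊨ₚ misstart τ)
            misstart-fails {τ} τ∈ p = both-elim p λ on (j , ¬q , _) →
              ¬q (cell-intro I (at π (j + 1)) τ (initial τ) (first-row on j) (constant τ∈))
              where
              constant : ∀ {τ j} → τ ∈ control ∷ below ∷ above ∷ [] → launch vs τ j ≡ initial τ
              constant (here refl)                 = refl
              constant (there (here refl))         = refl
              constant (there (there (here refl))) = refl

            misend-fails : ¬ (t , π ⊨ₚ misend)
            misend-fails p = both-elim p λ on (j , p , _) → both-elim p λ q ¬q →
              ¬q (cell-intro I (at π (suc j + 1)) stored (initial stored) (first-row on (suc j))
                   (⊕-final vs fresh j
                     (cell-elim I (at π (j + 1)) stored (initial stored) (first-row on j) q)))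

            violation-fails : ¬ (t , π ⊨ₚ violation)
            violation-fails (inj₁ p) with ⋁-elim t π properties desync p
            ... | γ , _ , q = desync-fails γ q
            violation-fails (inj₂ (inj₁ p))
              with ⋁-elim t π values (λ x → ⋁ values λ y → ⋁ values λ z → misstep x y z) p
            ... | x , _ , p with ⋁-elim t π values (λ y → ⋁ values λ z → misstep x y z) p
            ...   | y , _ , p with ⋁-elim t π values (misstep x y) p
            ...     | z , _ , p = misstep-fails x y z p
            violation-fails (inj₂ (inj₂ (inj₁ p)))
              with ⋁-elim t π (control ∷ below ∷ above ∷ []) misstart p
            ... | τ , τ∈ , q = misstart-fails τ∈ q
            violation-fails (inj₂ (inj₂ (inj₂ p))) = misend-fails p

        satisfied : unfoldingTree , root ⊨ sentence vs violation
        satisfied =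
          quantify-intro quantified (not (E ((X a ∧ X (literal vs)) or violation)))
            labelling labelling-off labelling-uniform
            λ { t t≗ (π , rooted , inj₁ p) → literal-fails t t≗ π rooted p
              ; t t≗ (π , rooted , inj₂ p) → violation-fails t t≗ π rooted p }

      -- The sentence holds exactly when the run never gets stuck

      sentence-sound : ∀ {vs} → K ⊨ᵗ sentence vs violation →
              ∀ i → fetch program (run vs i) ≢ nothing
      sentence-sound {vs} sat
        with quantify-elim quantified (not (E ((X a ∧ X (literal vs)) or violation))) sat
      ... | t , agree , unif , body =
        Extraction.never-stuck vs t
          (λ u s → sym (agree u (ap s 0) (signal-∉ s)))
          uniform
          (λ π rooted p → body (π , rooted , p))
        where
        uniform : ∀ s γ → Uniform ⁅ s ⁆ (prop s γ) t
        uniform s γ with unif (∈-map⁺ proj₂ (∈-quantified s γ))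
        -- The observation comes from some entry of the list with this proposition; decoding by
        -- `unap` shows that it is that of `s`.
        ... | o , x , u with quantified-prop x
        ...   | s′ , c , refl , eq
          with trans (sym (unap-ap s (code γ))) (trans (cong unap eq) (unap-ap s′ (suc c)))
        ...     | refl = u

      sentence-complete : ∀ {vs} → ¬ (initial stored ∈ vs) →
                 (∀ i → fetch program (run vs i) ≢ nothing) →
                 K ⊨ᵗ sentence vs violation
      sentence-complete {vs} = Construction.satisfied vs

-- Half-tapes as streams

pad : {k : ℕ} → List (Symbol k) → ℕ → Symbol k
pad xs = xs ⊕ λ _ → blank

cells : {k : ℕ} → Tape k → ℕ → Symbol k
cells τ = pad (Tape.scanned τ ∷ Tape.after τ)

right-before : ∀ {k} (s : Symbol k) τ →
               pad (Tape.before (writeMove s right τ)) ≗ (s ∷ []) ⊕ pad (Tape.before τ)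
right-before s (tape ls _ [])       zero    = refl
right-before s (tape ls _ [])       (suc j) = refl
right-before s (tape ls _ (r ∷ rs)) zero    = refl
right-before s (tape ls _ (r ∷ rs)) (suc j) = refl

right-cells : ∀ {k} (s : Symbol k) τ → cells (writeMove s right τ) ≗ cells τ ∘ suc
right-cells s (tape ls _ [])       zero    = refl
right-cells s (tape ls _ [])       (suc j) = refl
right-cells s (tape ls _ (r ∷ rs)) j       = refl

left-before : ∀ {k} (s : Symbol k) τ →
              pad (Tape.before (writeMove s left τ)) ≗ pad (Tape.before τ) ∘ suc
left-before s (tape []       _ rs) j = refl
left-before s (tape (l ∷ ls) _ rs) j = refl

left-cells : ∀ {k} (s : Symbol k) τ → cells (writeMove s left τ) ≗
             (pad (Tape.before τ) 0 ∷ s ∷ []) ⊕ (cells τ ∘ suc)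
left-cells s (tape []       _ rs) zero          = refl
left-cells s (tape []       _ rs) (suc zero)    = refl
left-cells s (tape []       _ rs) (suc (suc j)) = refl
left-cells s (tape (l ∷ ls) _ rs) zero          = refl
left-cells s (tape (l ∷ ls) _ rs) (suc zero)    = refl
left-cells s (tape (l ∷ ls) _ rs) (suc (suc j)) = refl

pad-bits : ∀ {k} xs ys → pad (map bit (xs ++ ys)) ≗ map bit xs ⊕ pad {k} (map bit ys)
pad-bits []       ys j       = refl
pad-bits (x ∷ xs) ys zero    = refl
pad-bits (x ∷ xs) ys (suc j) = pad-bits xs ys j

input-before : ∀ {k} xs j → blank ≡ pad (Tape.before (inputTape {k} xs)) j
input-before []       j = refl
input-before (x ∷ xs) j = refl

input-cells : ∀ {k} xs → pad (map bit xs) ≗ cells {k} (inputTape xs)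
input-cells []       zero    = refl
input-cells []       (suc j) = refl
input-cells (x ∷ xs) j       = refl

-- Simulating M on the encoding of the sentence itself

module Diagonal (M : TM) where

  open TM M

  -- An unread part of the tape is kept compressed: spell β stands for the
  -- word that a literal for β contributes to the encoding of the sentence,
  -- begin and end for everything that has to be read from there on.
  data Value : Set where
    state     : Fin states → Value
    symbol    : Symbol workSymbols → Value
    spell     : Bool → Value
    begin end : Value

  fixed : List Value
  fixed = symbol blank ∷ symbol (bit false) ∷ symbol (bit true) ∷
          spell false ∷ spell true ∷ begin ∷ end ∷ []

  values : List Value
  values = fixed ++ (map state (allFin states) ++ map (symbol ∘ work) (allFin workSymbols))

  ∈-values : ∀ v → v ∈ values
  ∈-values (state q)            = ∈-++⁺ʳ fixed (∈-++⁺ˡ (∈-map⁺ state (∈-allFin q)))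
  ∈-values (symbol blank)       = here refl
  ∈-values (symbol (bit false)) = there (here refl)
  ∈-values (symbol (bit true))  = there (there (here refl))
  ∈-values (symbol (work i))    =
    ∈-++⁺ʳ fixed (∈-++⁺ʳ (map state (allFin states)) (∈-map⁺ (symbol ∘ work) (∈-allFin i)))
  ∈-values (spell false)        = there (there (there (here refl)))
  ∈-values (spell true)         = there (there (there (there (here refl))))
  ∈-values begin                = there (there (there (there (there (here refl)))))
  ∈-values end                  = there (there (there (there (there (there (here refl))))))

  -- `begin` makes the first step load the input; `end` terminates the stored word.
  initial : Track → Value
  initial control = state start
  initial below   = symbol blank
  initial above   = begin
  initial stored  = end

  open Grid values ∈-values
  open Formula initial

  letter : Bool → Value
  letter β = symbol (bit β)

  -- The two readings of the stored word: as the literals that spell it, and as the encoding of the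
  -- violations. The `end` of the first reading calls for the second one, whose own end becomes
  -- blank tape.
  compressed literally : Value → Value
  compressed (symbol (bit β)) = spell β
  compressed v                = v
  literally end = symbol blank
  literally v   = v

  keep : Track → TrackUpdate Value
  keep τ = update [] τ 0 id

  Updates : Set
  Updates = TrackUpdate Value × TrackUpdate Value × TrackUpdate Value

  assemble : Updates → Instruction Value
  assemble (c , b , a) control = c
  assemble (c , b , a) below   = b
  assemble (c , b , a) above   = a
  assemble (c , b , a) stored  = keep stored

  idle : Updates
  idle = keep control , keep below , keep above

  refill : TrackUpdate Value → Updates
  refill u = keep control , keep below , u

  -- Acceptance gets stuck, whereas rejection idles for ever. A left move puts `l`, the cell to the
  -- left of the head, back onto `above`.
  perform : Symbol workSymbols → Action states workSymbols → Maybe Updates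
  perform l accept           = nothing
  perform l reject           = just idle
  perform l (move q s left)  = just
    ( update (state q ∷ []) control 0 id
    , update [] below 1 id
    , update (symbol l ∷ symbol s ∷ []) above 1 id )
  perform l (move q s right) = just
    ( update (state q ∷ []) control 0 id
    , update (symbol s ∷ []) below 0 id
    , update [] above 1 id )

  -- Idling in the last clause is a default for heads that do not form a machine configuration.
  updates : Value → Value → Value → Maybe Updates
  updates begin      _         _          =
    just (refill (update (map letter opening) stored 0 compressed))
  updates end        _         _          =
    just (refill (update (map letter closing) stored 0 literally))
  updates (spell β)  _         _          =
    just (refill (update (map letter (spelling (letter β))) above 1 id))
  updates (symbol s) (state q) (symbol l) = perform l (δ q s)
  updates _          _         _          = just idle

  program : Value → Value → Value → Maybe (Instruction Value)
  program x y z = Maybe.map assemble (updates x y z)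

  opaque
    -- There is no circularity: `program` refers to `opening`, `spelling` and `closing`, none of
    -- which depends on the program.
    suffix : List Bool
    suffix = pathEnc (violation program)

    suffix-enc : suffix ≡ pathEnc (violation program)
    suffix-enc = refl

  letters : List Value
  letters = map letter suffix

  word : List Bool
  word = opening ++ (concatMap spelling letters ++ (closing ++ suffix))

  configuration : ℕ → Configuration Value
  configuration = run program letters

  Stuck : ℕ → Set
  Stuck i = fetch program (configuration i) ≡ nothing

  -- The second reading of the stored word takes place when `end` is scanned, possibly long after
  -- the start.
  stored-kept : ∀ i j → configuration i stored j ≡ configuration 0 stored j
  stored-kept zero    j = refl
  stored-kept (suc i) j =
    trans (kept (fetch updates (configuration i)) (configuration i)) (stored-kept i j)
    where
    kept : ∀ m c → execute (Maybe.map assemble m) c stored j ≡ c stored j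
    kept nothing  c = refl
    kept (just _) c = refl

  -- Correctness of the simulation

  -- `f` is a partly compressed form of the tape content `w`. What follows an `end` in `f` is
  -- irrelevant, since unpacking replaces it.
  data Spells (f : ℕ → Value) (w : ℕ → Symbol workSymbols) : Set where
    plain   : (∀ j → f j ≡ symbol (w j)) → Spells f w
    cons    : f 0 ≡ symbol (w 0) → Spells (f ∘ suc) (w ∘ suc) → Spells f w
    spelled : ∀ β {w′} → f 0 ≡ spell β → Spells (f ∘ suc) w′ →
              w ≗ map bit (spelling (letter β)) ⊕ w′ → Spells f w
    ended   : f 0 ≡ end → w ≗ pad (map bit (closing ++ suffix)) → Spells f w

  Spells-resp : ∀ {f g w x} → f ≗ g → w ≗ x → Spells f w → Spells g x
  Spells-resp f≗g w≗x (plain eq)          =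
    plain λ j → trans (sym (f≗g j)) (trans (eq j) (cong symbol (w≗x j)))
  Spells-resp f≗g w≗x (cons eq s)         =
    cons (trans (sym (f≗g 0)) (trans eq (cong symbol (w≗x 0))))
         (Spells-resp (f≗g ∘ suc) (w≗x ∘ suc) s)
  Spells-resp f≗g w≗x (spelled β eq s w≗) =
    spelled β (trans (sym (f≗g 0)) eq) (Spells-resp (f≗g ∘ suc) (λ _ → refl) s)
            (λ j → trans (sym (w≗x j)) (w≗ j))
  Spells-resp f≗g w≗x (ended eq w≗)       =
    ended (trans (sym (f≗g 0)) eq) (λ j → trans (sym (w≗x j)) (w≗ j))

  Spells-⊕ : ∀ xs {f w} → Spells f w → Spells (map letter xs ⊕ f) (map bit xs ⊕ w)
  Spells-⊕ []       s = s
  Spells-⊕ (x ∷ xs) s = cons refl (Spells-⊕ xs s)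

  Ready : (ℕ → Value) → (ℕ → Symbol workSymbols) → Set
  Ready f w = f 0 ≡ symbol (w 0) × Spells (f ∘ suc) (w ∘ suc)

  record Simulates (R : (ℕ → Value) → (ℕ → Symbol workSymbols) → Set)
                   (c : Configuration Value) (q : Fin states)
                   (v w : ℕ → Symbol workSymbols) : Set where
    constructor simulates
    field
      in-state : c control 0 ≡ state q
      left-of  : ∀ j → c below j ≡ symbol (v j)
      right-of : R (c above) w

  -- No computation halts with a `move`, so the last clause is a filler.
  Outcome : Action states workSymbols → ℕ → Set
  Outcome accept       i = ∃[ k ] Stuck k
  Outcome reject       i = ∀ k → ¬ Stuck (k + i)
  Outcome (move _ _ _) i = ⊤

  outcome-step : ∀ r i {u} → fetch program (configuration i) ≡ just u →
                 Outcome r (suc i) → Outcome r i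
  outcome-step accept       i eq o         = o
  outcome-step reject       i eq o zero    = λ stuck → just≢nothing (trans (sym eq) stuck)
    where
    just≢nothing : ∀ {A : Set} {x : A} → just x ≢ nothing
    just≢nothing ()
  outcome-step reject       i eq o (suc k) = subst (¬_ ∘ Stuck) (+-suc k i) (o k)
  outcome-step (move _ _ _) i eq o         = tt

  fetched : ∀ {c x y z} → c above 0 ≡ x → c control 0 ≡ y → c below 0 ≡ z →
            fetch program c ≡ program x y z
  fetched refl refl refl = refl

  executed : ∀ i {m R q v w} → fetch program (configuration i) ≡ m →
             Simulates R (execute m (configuration i)) q v w →
             Simulates R (configuration (suc i)) q v w
  executed i refl s = s

  -- A compressed head is expanded in a single step, since the words that
  -- spell and end stand for are not empty.
  unpack : ∀ r {q v w} i → Simulates Spells (configuration i) q v w →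
           (∀ k → Simulates Ready (configuration k) q v w → Outcome r k) →
           Outcome r i
  unpack r i (simulates st l (plain eq)) finish =
    finish i (simulates st l (eq 0 , plain (eq ∘ suc)))
  unpack r i (simulates st l (cons eq s)) finish =
    finish i (simulates st l (eq , s))
  unpack r {w = w} i (simulates st l (spelled β eq s w≗)) finish =
    outcome-step r i fetch≡ (finish (suc i) (executed i fetch≡ (simulates st l expanded)))
    where
    fetch≡ : fetch program (configuration i) ≡
             just (assemble (refill (update (map letter (spelling (letter β))) above 1 id)))
    fetch≡ = fetched {configuration i} eq refl refl

    expanded : Ready (map letter (spelling (letter β)) ⊕ (configuration i above ∘ suc)) w
    expanded = cong symbol (sym (w≗ 0)) ,
               Spells-resp (λ _ → refl) (λ j → sym (w≗ (suc j)))
                           (Spells-⊕ (List.drop 1 (spelling (letter β))) s)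
  unpack r {w = w} i (simulates st l (ended eq w≗)) finish =
    outcome-step r i fetch≡ (finish (suc i)
      (executed i fetch≡ (simulates st l (expanded 0 , plain (expanded ∘ suc)))))
    where
    fetch≡ : fetch program (configuration i) ≡
             just (assemble (refill (update (map letter closing) stored 0 literally)))
    fetch≡ = fetched {configuration i} eq refl refl

    literal-letters : ∀ βs j → literally ((map letter βs ⊕ λ _ → end) j) ≡
                               symbol (pad (map bit βs) j)
    literal-letters []       j       = refl
    literal-letters (β ∷ βs) zero    = refl
    literal-letters (β ∷ βs) (suc j) = literal-letters βs j

    appended : ∀ xs {f} → (∀ j → f j ≡ symbol (pad (map bit suffix) j)) →
               ∀ j → (map letter xs ⊕ f) j ≡ symbol (pad (map bit (xs ++ suffix)) j)
    appended []       eq j       = eq j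
    appended (x ∷ xs) eq zero    = refl
    appended (x ∷ xs) eq (suc j) = appended xs eq j

    expanded : ∀ j → (map letter closing ⊕ λ j → literally (configuration i stored j)) j ≡
                     symbol (w j)
    expanded j =
      trans (appended closing
              (λ j → trans (cong literally (stored-kept i j)) (literal-letters suffix j)) j)
            (cong symbol (sym (w≗ j)))

  Represents : ((ℕ → Value) → (ℕ → Symbol workSymbols) → Set) →
               Configuration Value → Fin states → Tape workSymbols → Set
  Represents R c q τ = Simulates R c q (pad (Tape.before τ)) (cells τ)

  scanned-left : Tape workSymbols → Symbol workSymbols
  scanned-left τ = pad (Tape.before τ) 0

  performed : ∀ i q τ {α} → Represents Ready (configuration i) q τ →
              δ q (Tape.scanned τ) ≡ α →
              fetch program (configuration i) ≡
              Maybe.map assemble (perform (scanned-left τ) α)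
  performed i q τ (simulates st l (head , _)) eq =
    trans (fetched {configuration i} head st (l 0))
          (cong (Maybe.map assemble ∘ perform (scanned-left τ)) eq)

  move-left : ∀ {c q} q′ s τ → Represents Ready c q τ →
              Represents Spells
                (execute (Maybe.map assemble (perform (scanned-left τ) (move q′ s left))) c)
                q′ (writeMove s left τ)
  move-left {c} q′ s τ (simulates st l (_ , rest)) = simulates refl
    (λ j → trans (l (suc j)) (cong symbol (sym (left-before s τ j))))
    (Spells-resp (λ _ → refl) (sym ∘ left-cells s τ) written)
    where
    written : Spells ((symbol (scanned-left τ) ∷ symbol s ∷ []) ⊕ (c above ∘ suc))
                     ((scanned-left τ ∷ s ∷ []) ⊕ (cells τ ∘ suc))
    written = cons refl (cons refl rest)

  move-right : ∀ {c q} q′ s τ → Represents Ready c q τ →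
               Represents Spells
                 (execute (Maybe.map assemble (perform (scanned-left τ) (move q′ s right))) c)
                 q′ (writeMove s right τ)
  move-right {c} q′ s τ (simulates st l (_ , rest)) = simulates refl
    (λ j → trans (written j) (cong symbol (sym (right-before s τ j))))
    (Spells-resp (λ _ → refl) (sym ∘ right-cells s τ) rest)
    where
    written : ∀ j → ((symbol s ∷ []) ⊕ c below) j ≡ symbol (((s ∷ []) ⊕ pad (Tape.before τ)) j)
    written zero    = refl
    written (suc j) = l j

  -- `idle` leaves the three heads as they are, so the same instruction is fetched again.
  idling : ∀ i → fetch program (configuration i) ≡ just (assemble idle) →
           ∀ k → fetch program (configuration (k + i)) ≡ just (assemble idle)
  idling i eq zero    = eq
  idling i eq (suc k) =
    trans (cong (λ m → fetch program (execute m (configuration (k + i)))) (idling i eq k))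
          (idling i eq k)

  mutual
    -- Induction on the halting computation: each move takes one row, after one row of unpacking if
    -- the head is compressed.
    simulate : ∀ {q τ r} → Halts M q τ r →
               ∀ i → Represents Spells (configuration i) q τ → Outcome r i
    simulate {r = r} h i s = unpack r i s (simulate-ready h)

    simulate-ready : ∀ {q τ r} → Halts M q τ r →
                     ∀ i → Represents Ready (configuration i) q τ → Outcome r i
    simulate-ready {q} {τ} (accepting eq) i s = i , performed i q τ s eq
    simulate-ready {q} {τ} (rejecting eq) i s k stuck
      with trans (sym (idling i (performed i q τ s eq) k)) stuck
    ... | ()
    simulate-ready {q} {τ} {r} (moving {q′} {a} {left} eq h) i s =
      outcome-step r i (performed i q τ s eq)
        (simulate h (suc i) (executed i (performed i q τ s eq) (move-left q′ a τ s)))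
    simulate-ready {q} {τ} {r} (moving {q′} {a} {right} eq h) i s =
      outcome-step r i (performed i q τ s eq)
        (simulate h (suc i) (executed i (performed i q τ s eq) (move-right q′ a τ s)))

  -- The diagonal instance

  compressed-letters : ∀ βs →
    Spells (compressed ∘ (map letter βs ⊕ λ _ → end))
           (pad (map bit (concatMap spelling (map letter βs) ++ (closing ++ suffix))))
  compressed-letters []       = ended refl λ _ → refl
  compressed-letters (β ∷ βs) = spelled β refl (compressed-letters βs) λ j →
    trans (cong (λ bs → pad (map bit bs) j)
                (++-assoc (spelling (letter β)) later (closing ++ suffix)))
          (pad-bits (spelling (letter β)) (later ++ (closing ++ suffix)) j)
    where
    later : List Bool
    later = concatMap spelling (map letter βs)

  -- Row 0 scans `begin`, so row 1 holds `opening` followed by the compressed reading of the stored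
  -- word.
  loaded : Represents Spells (configuration 1) start (inputTape word)
  loaded = simulates refl (cong symbol ∘ input-before word)
    (Spells-resp (λ _ → refl)
      (λ j → trans (sym (pad-bits opening (concatMap spelling letters ++ (closing ++ suffix)) j))
                   (input-cells word j))
      (Spells-⊕ opening (compressed-letters suffix)))

  end-fresh : ¬ (end ∈ letters)
  end-fresh x with ∈-map⁻ letter x
  ... | _ , _ , ()

  opaque
    diagonal : Instance
    diagonal = 2 , K , sentence letters (violation program)

    diagonal-enc : encode diagonal ≡ word
    diagonal-enc =
      trans (sentence-enc letters (violation program))
            (cong (λ bs → opening ++ (concatMap spelling letters ++ (closing ++ bs)))
                  (sym suffix-enc))

    diagonal-sound : Yes diagonal → ∀ i → ¬ Stuck i
    diagonal-sound = sentence-sound program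

    diagonal-complete : (∀ i → ¬ Stuck i) → Yes diagonal
    diagonal-complete = sentence-complete program end-fresh

  halting : ∀ {r} → Halts M start (inputTape (encode diagonal)) r → Outcome r 1
  halting {r} h =
    simulate (subst (λ bs → Halts M start (inputTape bs) r) diagonal-enc h) 1 loaded

  undecided : ¬ (M Decides ModelChecking)
  undecided decides with decides diagonal
  ... | inj₁ (accepts , holds) =
    let k , stuck = halting accepts in diagonal-sound holds k stuck
  ... | inj₂ (rejects , fails) = fails (diagonal-complete λ i stuck →
    -- `halting` covers the rows from 1 on; row 0 fetches the loading instruction and is not stuck
    -- either.
    outcome-step reject 0 refl (halting rejects) i (subst Stuck (sym (+-identityʳ i)) stuck))

theorem3 : Undecidable ModelChecking
theorem3 (M , decides) = Diagonal.undecided M decides
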